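{- For every positive integer $n$, \[\mathsf{pf}_n(132)=\mathsf{pf}_n(231)=\sum_{\alpha\vDash n}\det\left[\binom{j-i+\sum_{\ell=1}^{i}\alpha_\ell}{j-(i-1)}\right]\det\left[\binom{j+\sum_{\ell=1}^{i}\alpha_{k+1-\ell}}{j-(i-1)}\right],\] \[\mathsf{pf}_n(213)=\mathsf{pf}_n(312)=\sum_{\alpha\vDash n}\det\left[\binom{j-i+\sum_{\ell=1}^{i}\alpha_\ell}{j-(i-1)}\right]\det\left[\binom{j+\sum_{\ell=1}^{i}\alpha_{\ell}}{j-(i-1)}\right],\] where the sums run over all compositions $\alpha=(\alpha_1,\dots,\alpha_k)$ of $n$, $k$ is the number of parts of $\alpha$, and in every determinant the indices range over $1\le i,j\le k-1$ (empty determinants equal $1$).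
   Context: $[n]=\{1,\dots,n\}$. A tuple $p=(p_1,\dots,p_n)\in[n]^n$ is a parking function if its weakly increasing rearrangement $(p'_1,\dots,p'_n)$ satisfies $p'_i\le i$ for all $i$. To a parking function $p$ associate the permutation $\pi(p)$ obtained by listing, for $s=1,2,\dots,n$ in turn, the indices $j$ with $p_j=s$ in increasing order, and concatenating these lists. A permutation $\pi$ avoids $\sigma\in\mathfrak S_3$ if no subsequence of $\pi$ of length 3 is order-isomorphic to $\sigma$. For $\sigma\in\mathfrak S_3$, $\mathsf{pf}_n(\sigma)$ is the number of parking functions $p$ of length $n$ such that $\pi(p)$ avoids $\sigma$. Binomial coefficients $\binom{N}{r}$ with $r<0$ are $0$. -}

module Defs where

import Algebra.Properties.CommutativeMonoid.Sum as Sum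
open import Data.Fin.Base using (Fin; zero; suc; toℕ; punchIn; _<_)
open import Data.Fin.Patterns using (0F; 1F; 2F)
import Data.Fin.Properties as Fin
open import Data.Integer.Base as ℤ using (ℤ; +_; -[1+_]; 0ℤ; 1ℤ; -1ℤ)
import Data.Integer.Properties as ℤ
open import Data.List.Base as List
  using (List; []; _∷_; allFin; cartesianProductWith; concatMap; filter; foldr; length; take; reverse)
import Data.List.Sort.InsertionSort as InsertionSort
open import Data.Nat.Base as ℕ using (ℕ; zero; suc; _+_; _∸_; _≤_)
open import Data.Nat.Combinatorics using (_C_)
open import Data.Nat.ListAction using (sum)
import Data.Nat.Properties as ℕ
open import Data.Product.Base using (_×_; _,_; ∃-syntax; uncurry)
open import Data.Vec.Base as Vec using (Vec; []; _∷_)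
open import Function.Bundles using (_⇔_; mk⇔; module Equivalence)
open import Relation.Nullary using (Dec; ¬_)
open import Relation.Nullary.Decidable using (¬?; _×-dec_; _→-dec_; map′)

-- Throughout, the set [n] = {1, …, n} is represented by Fin n, the element
-- a : Fin n standing for the number 1 + toℕ a.

-- Every tuple in [m]^k exactly once.
tuples : (m k : ℕ) → List (Vec (Fin m) k)
tuples m zero    = [] ∷ []
tuples m (suc k) = cartesianProductWith _∷_ (allFin m) (tuples m k)

rearrangement : ∀ {n k} → Vec (Fin n) k → List (Fin n)
rearrangement {n} p = InsertionSort.sort (Fin.≤-decTotalOrder n) (Vec.toList p)

-- p′ᵢ ≤ i for all i; values and positions are both shifted down by one,
-- so the inequality is unchanged.
IsParking : ∀ {n} → Vec (Fin n) n → Set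
IsParking p = (i : Fin (length (rearrangement p))) →
              toℕ (List.lookup (rearrangement p) i) ≤ toℕ i

isParking? : ∀ {n} (p : Vec (Fin n) n) → Dec (IsParking p)
isParking? p =
  Fin.all? λ i → toℕ (List.lookup (rearrangement p) i) ℕ.≤? toℕ i

-- The permutation π(p) in one-line notation.
π : ∀ {n} → Vec (Fin n) n → List (Fin n)
π {n} p =
  concatMap (λ s → filter (λ j → Vec.lookup p j Fin.≟ s) (allFin n)) (allFin n)

OrderIsomorphic : ∀ {m n k} → Vec (Fin m) k → Vec (Fin n) k → Set
OrderIsomorphic u v =
  ∀ a b → Vec.lookup u a < Vec.lookup u b ⇔ Vec.lookup v a < Vec.lookup v b

orderIsomorphic? : ∀ {m n k} (u : Vec (Fin m) k) (v : Vec (Fin n) k) →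
                   Dec (OrderIsomorphic u v)
orderIsomorphic? u v = Fin.all? λ a → Fin.all? λ b →
  let u? = Vec.lookup u a Fin.<? Vec.lookup u b
      v? = Vec.lookup v a Fin.<? Vec.lookup v b
  in map′ (uncurry mk⇔) (λ e → Equivalence.to e , Equivalence.from e)
          ((u? →-dec v?) ×-dec (v? →-dec u?))

subword₃ : ∀ {n} (w : List (Fin n)) (a b c : Fin (length w)) → Vec (Fin n) 3
subword₃ w a b c = List.lookup w a ∷ List.lookup w b ∷ List.lookup w c ∷ []

Contains : ∀ {n} → List (Fin n) → Vec (Fin 3) 3 → Set
Contains w σ =
  ∃[ a ] ∃[ b ] ∃[ c ] a < b × b < c × OrderIsomorphic (subword₃ w a b c) σ

contains? : ∀ {n} (w : List (Fin n)) (σ : Vec (Fin 3) 3) → Dec (Contains w σ)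
contains? w σ = Fin.any? λ a → Fin.any? λ b → Fin.any? λ c →
  (a Fin.<? b) ×-dec (b Fin.<? c) ×-dec orderIsomorphic? (subword₃ w a b c) σ

Avoids : ∀ {n} → List (Fin n) → Vec (Fin 3) 3 → Set
Avoids w σ = ¬ Contains w σ

pf : ℕ → Vec (Fin 3) 3 → ℕ
pf n σ =
  length (filter (λ p → isParking? p ×-dec ¬? (contains? (π p) σ)) (tuples n n))

σ132 σ213 σ231 σ312 : Vec (Fin 3) 3
σ132 = 0F ∷ 2F ∷ 1F ∷ []
σ213 = 1F ∷ 0F ∷ 2F ∷ []
σ231 = 1F ∷ 2F ∷ 0F ∷ []
σ312 = 2F ∷ 0F ∷ 1F ∷ []

-- Every composition of n exactly once: a composition of n + 1 arises from a
-- unique composition of n, either by prepending a part 1 or by increasing the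
-- first part by 1.
compositions : ℕ → List (List ℕ)
compositions zero    = [] ∷ []
compositions (suc n) = concatMap extend (compositions n)
  where
  extend : List ℕ → List (List ℕ)
  extend []      = (1 ∷ []) ∷ []
  extend (a ∷ α) = (1 ∷ a ∷ α) ∷ (suc a ∷ α) ∷ []

∑-compositions : ℕ → (List ℕ → ℤ) → ℤ
∑-compositions n f = foldr (λ α s → f α ℤ.+ s) 0ℤ (compositions n)

syntax ∑-compositions n (λ α → e) = ∑[ α ⊨ n ] e

binom : ℕ → ℤ → ℤ
binom N (+ r)    = + (N C r)
binom N -[1+ _ ] = 0ℤ

Matrix : ℕ → Set
Matrix m = Fin m → Fin m → ℤ

sumℤ : ∀ {m} → (Fin m → ℤ) → ℤ
sumℤ = Sum.sum ℤ.+-0-commutativeMonoid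

-- Laplace expansion along the first row.
det : ∀ {m} → Matrix m → ℤ
det {zero}  A = 1ℤ
det {suc m} A = sumℤ λ c →
  -1ℤ ℤ.^ toℕ c ℤ.* A zero c ℤ.* det (λ i j → A (suc i) (punchIn c j))

-- The m × m matrix with entries f i j for 1 ≤ i , j ≤ m.
matrix : (m : ℕ) → (ℕ → ℕ → ℤ) → Matrix m
matrix m f i j = f (suc (toℕ i)) (suc (toℕ j))

-- ∑_{ℓ=1}^{i} α_ℓ
prefixSum : List ℕ → ℕ → ℕ
prefixSum α i = sum (take i α)

-- ∑_{ℓ=1}^{i} α_{k+1-ℓ}
suffixSum : List ℕ → ℕ → ℕ
suffixSum α i = prefixSum (reverse α) i

-- In matrixA the truncated subtraction is exact: the first i parts of a
-- composition are positive, so their sum is at least i.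
matrixA matrixB matrixC : (α : List ℕ) → Matrix (length α ∸ 1)
matrixA α = matrix (length α ∸ 1) λ i j →
  binom ((j + prefixSum α i) ∸ i) (+ j ℤ.- (+ i ℤ.- 1ℤ))
matrixB α = matrix (length α ∸ 1) λ i j →
  binom (j + suffixSum α i) (+ j ℤ.- (+ i ℤ.- 1ℤ))
matrixC α = matrix (length α ∸ 1) λ i j →
  binom (j + prefixSum α i) (+ j ℤ.- (+ i ℤ.- 1ℤ))

{-# OPTIONS --safe #-}

-- An index j precedes an index k in π(p) iff (p_j , j) is lexicographically below (p_k , k), so a
-- pattern in π(p) is a pattern in the word p itself; for instance 213 becomes i < j < k with
-- p_j < p_i ≤ p_k. Removing the first letter t of a word avoiding this, the letters ≥ t must all
-- come before the letters < t, and both parts are arbitrary avoiding words; for 312 they come in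
-- the opposite order. Both patterns thus satisfy the same recursion on the multiplicities of the
-- letters, which is solved by a lattice path count. Reversing words and the order of the letters
-- turns 213 and 312 into 132 and 231, and reverses the list α of multiplicities.
--
-- The letters of a parking function with multiplicities α are 0 < t₁ < t₂ < ⋯ with
-- tᵢ ≤ α₁ + ⋯ + αᵢ, and the lattice paths too are such strictly increasing sequences below
-- increasing bounds Bᵢ. Their number is the determinant of the Hessenberg matrix
-- h_{j-i+1}(1^{Bᵢ}), by comparing its Laplace expansion with the recursion in the lower bound.

module Submission where

open import Defs
open import Data.Empty using (⊥-elim)
open import Data.Fin.Base as Fin using (Fin; zero; suc; toℕ; fromℕ<; punchIn)
open import Data.Fin.Patterns using (0F; 1F; 2F)
import Data.Fin.Properties as Fin
open import Data.Integer.Base as ℤ using (ℤ; +_; 0ℤ; 1ℤ; -1ℤ)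
import Data.Integer.Properties as ℤ
open import Data.Integer.Tactic.RingSolver using () renaming (solve-∀ to ℤ-solve-∀)
open import Data.List.Base hiding (sum; find; and; or; all; any)
open import Data.List.Membership.Propositional using (_∈_; find)
open import Data.List.Membership.Propositional.Properties
open import Data.List.Membership.Propositional.Properties.WithK using (unique∧set⇒bag)
open import Data.List.Properties
open import Data.List.Relation.Binary.BagAndSetEquality using (∼bag⇒↭)
open import Data.List.Relation.Binary.Disjoint.Propositional using (Disjoint)
open import Data.List.Relation.Binary.Permutation.Propositional
  using (_↭_; ↭-refl; ↭-sym; ↭-trans; ↭-reflexive; ↭⇒↭ₛ; prep)
open import Data.List.Relation.Binary.Permutation.Propositional.Properties
  using (↭-length; ↭-reverse; ++⁺; ++-comm; shift; drop-∷; All-resp-↭; filter-↭; ∈-resp-↭; ↭-empty-inv)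
  renaming (map⁺ to ↭-map⁺)
open import Data.List.Relation.Binary.Pointwise using (Pointwise-≡⇒≡)
open import Data.List.Relation.Unary.All as All using (All; []; _∷_)
import Data.List.Relation.Unary.All.Properties as All
open import Data.List.Relation.Unary.AllPairs as AllPairs using (AllPairs; []; _∷_)
import Data.List.Relation.Unary.AllPairs.Properties as AllPairs
open import Data.List.Relation.Unary.Any as Any using (Any; here; there)
open import Data.List.Relation.Unary.Any.Properties using (lookup-index)
open import Data.List.Relation.Unary.Sorted.TotalOrder.Properties
  using (AllPairs⇒Sorted; Sorted⇒AllPairs; ↗↭↗⇒≋)
open import Data.List.Relation.Unary.Unique.Propositional using (Unique)
import Data.List.Relation.Unary.Unique.Propositional.Properties as Unique
open import Data.List.Sort.Base using (module SortingAlgorithm)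
import Data.List.Sort.InsertionSort as InsertionSort
open import Data.Nat.Base as ℕ
  using (ℕ; zero; suc; _+_; _*_; _∸_; pred; _≤_; _<_; _>_; z≤n; s≤s; NonZero)
open import Data.Nat.Combinatorics using (_C_; k>n⇒nCk≡0; nCk+nC[k+1]≡[n+1]C[k+1])
open import Data.Nat.ListAction using (sum)
open import Data.Nat.ListAction.Properties using (sum-↭)
import Data.Nat.Properties as ℕ
open import Data.Nat.Tactic.RingSolver using (solve-∀)
open import Data.Product.Base using (_×_; _,_; proj₁; proj₂; ∃-syntax; map₁)
open import Data.Sum.Base using (_⊎_; inj₁; inj₂)
open import Data.Unit.Base using (⊤; tt)
open import Data.Vec.Base as Vec using (Vec; []; _∷_)
import Data.Vec.Properties as Vec
open import Function.Base using (_∘_; flip)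
open import Function.Bundles using (_⇔_; mk⇔; module Equivalence)
open import Level using (Level)
import Relation.Binary.Construct.Flip.EqAndOrd as Flip
open import Relation.Binary.Core using (Rel)
open import Relation.Binary.Definitions using (tri<; tri≈; tri>)
open import Relation.Binary.PropositionalEquality
open import Relation.Binary.Structures using (IsStrictTotalOrder)
open import Relation.Nullary using (¬_; yes; no; ¬?)
open import Relation.Nullary.Decidable using (True; toWitness; _×-dec_; _→-dec_)
open import Relation.Unary using (Pred; Decidable)
open ≡-Reasoning

private
  variable
    a b ℓ : Level
    A : Set a
    B : Set b

-- Strictly increasing sequences and Hessenberg determinants

∑< : ℕ → (ℕ → ℕ) → ℕ
∑< n f = sum (applyUpTo f n)

∑<-cong : ∀ n {f g : ℕ → ℕ} → (∀ i → f i ≡ g i) → ∑< n f ≡ ∑< n g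
∑<-cong zero    f≗g = refl
∑<-cong (suc n) f≗g = cong₂ _+_ (f≗g 0) (∑<-cong n (f≗g ∘ suc))

-- The number of t₀ < ⋯ < tₘ₋₁ with lo ≤ t₀ and tᵢ ≤ B i.
columns : ℕ → (m : ℕ) → (ℕ → ℕ) → ℕ
columns lo zero    B = 1
columns lo (suc m) B = ∑< (suc (B 0) ∸ lo) λ i → columns (suc (lo + i)) m (B ∘ suc)

columns-cong : ∀ lo m {B B′} → (∀ i → i < m → B i ≡ B′ i) →
               columns lo m B ≡ columns lo m B′
columns-cong lo zero    B≗B′ = refl
columns-cong lo (suc m) {B} {B′} B≗B′ rewrite B≗B′ 0 (s≤s z≤n) =
  ∑<-cong (suc (B′ 0) ∸ lo) λ i →
    columns-cong (suc (lo + i)) m λ i i<m → B≗B′ (suc i) (s≤s i<m)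

columns-empty : ∀ m B → columns (suc (B 0)) (suc m) B ≡ 0
columns-empty m B rewrite ℕ.n∸n≡0 (B 0) = refl

-- Either t₀ = `lo`, or t₀ > `lo`. This recursion in the lower bound, with `B` kept, is what gets
-- compared with the Laplace expansion.
columns-step : ∀ lo m B → lo ≤ B 0 →
               columns lo (suc m) B ≡ columns (suc lo) m (B ∘ suc) + columns (suc lo) (suc m) B
columns-step lo m B lo≤ rewrite ℕ.+-∸-assoc 1 lo≤ =
  cong₂ _+_ (cong (λ x → columns (suc x) m (B ∘ suc)) (ℕ.+-identityʳ lo))
            (∑<-cong (B 0 ∸ lo) λ i → cong (λ x → columns (suc x) m (B ∘ suc)) (ℕ.+-suc lo i))

-- The complete homogeneous symmetric polynomial of degree r in k variables, at (1, …, 1).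
h : ℕ → ℕ → ℕ
h k zero    = 1
h k (suc r) = (k + r) C suc r

-- A monomial of degree `r + 1` in `k + 1` variables contains the last variable or it does not.
h-pascal : ∀ k r → h (suc k) (suc r) ≡ h (suc k) r + h k (suc r)
h-pascal k zero    = sym (nCk+nC[k+1]≡[n+1]C[k+1] (k + 0) 0)
h-pascal k (suc r) = begin
  suc (k + suc r) C suc (suc r)               ≡⟨ nCk+nC[k+1]≡[n+1]C[k+1] (k + suc r) (suc r) ⟨
  (k + suc r) C suc r + (k + suc r) C suc (suc r)
    ≡⟨ cong (λ x → x C suc r + (k + suc r) C suc (suc r)) (ℕ.+-suc k r) ⟩
  suc (k + r) C suc r + (k + suc r) C suc (suc r) ∎

h-zero : ∀ r → h 0 (suc r) ≡ 0
h-zero r = k>n⇒nCk≡0 (ℕ.n<1+n r)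

Family : Set
Family = (m : ℕ) → (ℕ → ℕ) → ℤ

-- ∑_c (-1)^c h_{r+c}(k) f(B_c, …, B_{m-1})
alternating : ℕ → ℕ → Family → Family
alternating k r f zero    B = + h k r ℤ.* f 0 B
alternating k r f (suc m) B =
  + h k r ℤ.* f (suc m) B ℤ.- alternating k (suc r) f m (B ∘ suc)

alternating-pascal : ∀ k r f m B →
  alternating (suc k) (suc r) f m B ≡ alternating (suc k) r f m B ℤ.+ alternating k (suc r) f m B
alternating-pascal k r f zero B rewrite h-pascal k r = begin
  + (h (suc k) r + h k (suc r)) ℤ.* f 0 B
    ≡⟨ cong (ℤ._* f 0 B) (ℤ.pos-+ (h (suc k) r) _) ⟩
  (+ h (suc k) r ℤ.+ + h k (suc r)) ℤ.* f 0 B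
    ≡⟨ ℤ.*-distribʳ-+ (f 0 B) (+ h (suc k) r) (+ h k (suc r)) ⟩
  + h (suc k) r ℤ.* f 0 B ℤ.+ + h k (suc r) ℤ.* f 0 B ∎
alternating-pascal k r f (suc m) B
  rewrite h-pascal k r | alternating-pascal k (suc r) f m (B ∘ suc)
        | ℤ.pos-+ (h (suc k) r) (h k (suc r)) =
  regroup (+ h (suc k) r) (+ h k (suc r)) (f (suc m) B)
          (alternating (suc k) (suc r) f m (B ∘ suc)) (alternating k (suc (suc r)) f m (B ∘ suc))
  where
  regroup : ∀ a b x y z → (a ℤ.+ b) ℤ.* x ℤ.- (y ℤ.+ z) ≡ (a ℤ.* x ℤ.- y) ℤ.+ (b ℤ.* x ℤ.- z)
  regroup = ℤ-solve-∀

-- The leading terms agree because h₀ is 1 for any number of variables; the others are split by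
-- `alternating-pascal`.
alternating-step : ∀ k f m B →
  alternating (suc k) 0 f (suc m) B ≡
  alternating k 0 f (suc m) B ℤ.- alternating (suc k) 0 f m (B ∘ suc)
alternating-step k f m B rewrite alternating-pascal k 0 f m (B ∘ suc) =
  regroup (1ℤ ℤ.* f (suc m) B) _ _
  where
  regroup : ∀ x y z → x ℤ.- (y ℤ.+ z) ≡ (x ℤ.- z) ℤ.- y
  regroup = ℤ-solve-∀

alternating-zero : ∀ f r m B → alternating 0 (suc r) f m B ≡ 0ℤ
alternating-zero f r zero    B rewrite h-zero r = refl
alternating-zero f r (suc m) B rewrite h-zero r | alternating-zero f (suc r) m (B ∘ suc) = refl

alternating-0-0 : ∀ f m B → alternating 0 0 f m B ≡ f m B
alternating-0-0 f zero    B = ℤ.*-identityˡ (f 0 B)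
alternating-0-0 f (suc m) B rewrite alternating-zero f 0 m (B ∘ suc) =
  trans (ℤ.+-identityʳ _) (ℤ.*-identityˡ (f (suc m) B))

columnsℤ : ℕ → Family
columnsℤ lo m B = + columns lo m B

-- Both sides satisfy the recursion of `alternating-step`, so induction on `k` and `m` leads to
-- `k = 0`, where the claim is `columns-step`. In effect one variable is traded for one unit of the
-- lower bound.
alternating-columns-shift : ∀ k lo m B → (∀ i → lo ≤ B i) →
  alternating (suc k) 0 (columnsℤ lo) m B ≡ alternating k 0 (columnsℤ (suc lo)) m B
alternating-columns-shift k lo zero B lo≤ = refl
alternating-columns-shift zero lo (suc m) B lo≤ = begin
  alternating 1 0 (columnsℤ lo) (suc m) B
    ≡⟨ alternating-step 0 (columnsℤ lo) m B ⟩
  alternating 0 0 (columnsℤ lo) (suc m) B ℤ.- alternating 1 0 (columnsℤ lo) m (B ∘ suc)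
    ≡⟨ cong₂ ℤ._-_ (alternating-0-0 (columnsℤ lo) (suc m) B)
         (trans (alternating-columns-shift 0 lo m (B ∘ suc) (lo≤ ∘ suc))
                (alternating-0-0 (columnsℤ (suc lo)) m (B ∘ suc))) ⟩
  columnsℤ lo (suc m) B ℤ.- columnsℤ (suc lo) m (B ∘ suc)
    ≡⟨ cong (λ x → + x ℤ.- columnsℤ (suc lo) m (B ∘ suc)) (columns-step lo m B (lo≤ 0)) ⟩
  + (columns (suc lo) m (B ∘ suc) + columns (suc lo) (suc m) B) ℤ.- columnsℤ (suc lo) m (B ∘ suc)
    ≡⟨ cancel (columns (suc lo) m (B ∘ suc)) (columns (suc lo) (suc m) B) ⟩
  columnsℤ (suc lo) (suc m) B
    ≡⟨ alternating-0-0 (columnsℤ (suc lo)) (suc m) B ⟨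
  alternating 0 0 (columnsℤ (suc lo)) (suc m) B ∎
  where
  cancelℤ : ∀ x y → (x ℤ.+ y) ℤ.- x ≡ y
  cancelℤ = ℤ-solve-∀
  cancel : ∀ x y → + (x + y) ℤ.- + x ≡ + y
  cancel x y = trans (cong (ℤ._- + x) (ℤ.pos-+ x y)) (cancelℤ (+ x) (+ y))
alternating-columns-shift (suc k) lo (suc m) B lo≤ = begin
  alternating (suc (suc k)) 0 (columnsℤ lo) (suc m) B
    ≡⟨ alternating-step (suc k) (columnsℤ lo) m B ⟩
  alternating (suc k) 0 (columnsℤ lo) (suc m) B ℤ.-
  alternating (suc (suc k)) 0 (columnsℤ lo) m (B ∘ suc)
    ≡⟨ cong₂ ℤ._-_ (alternating-columns-shift k lo (suc m) B lo≤)
         (alternating-columns-shift (suc k) lo m (B ∘ suc) (lo≤ ∘ suc)) ⟩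
  alternating k 0 (columnsℤ (suc lo)) (suc m) B ℤ.-
  alternating (suc k) 0 (columnsℤ (suc lo)) m (B ∘ suc)
    ≡⟨ alternating-step k (columnsℤ (suc lo)) m B ⟨
  alternating (suc k) 0 (columnsℤ (suc lo)) (suc m) B ∎

Monotone : (ℕ → ℕ) → Set
Monotone B = ∀ i → B i ≤ B (suc i)

monotone⇒B₀≤ : ∀ {B} → Monotone B → ∀ i → B 0 ≤ B i
monotone⇒B₀≤ mono zero    = ℕ.≤-refl
monotone⇒B₀≤ mono (suc i) = ℕ.≤-trans (monotone⇒B₀≤ mono i) (mono i)

-- Trading all `k` variables raises the lower bound to `B 0 + 1`, and then no value is left for t₀.
alternating-columns : ∀ k lo m B → Monotone B → lo + k ≡ suc (B 0) →
                      alternating k 0 (columnsℤ lo) (suc m) B ≡ 0ℤ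
alternating-columns zero lo m B mono eq
  rewrite trans (sym (ℕ.+-identityʳ lo)) eq =
  trans (alternating-0-0 (columnsℤ (suc (B 0))) (suc m) B) (cong +_ (columns-empty m B))
alternating-columns (suc k) lo m B mono eq =
  trans (alternating-columns-shift k lo (suc m) B
          (λ i → ℕ.≤-trans (ℕ.m+n≤o⇒m≤o lo (ℕ.≤-reflexive eq′)) (monotone⇒B₀≤ mono i)))
        (alternating-columns k (suc lo) m B mono (cong suc eq′))
  where
  eq′ : lo + k ≡ B 0
  eq′ = ℕ.suc-injective (trans (sym (ℕ.+-suc lo k)) eq)

-- Agreement is asked for at most `m` bounds only, so that an induction hypothesis can supply it.
alternating-cong : ∀ k r {f g : Family} m B → Monotone B →
  (∀ m′ B′ → m′ ≤ m → Monotone B′ → f m′ B′ ≡ g m′ B′) →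
  alternating k r f m B ≡ alternating k r g m B
alternating-cong k r zero    B mono f≗g = cong (+ h k r ℤ.*_) (f≗g 0 B ℕ.≤-refl mono)
alternating-cong k r (suc m) B mono f≗g =
  cong₂ (λ x y → + h k r ℤ.* x ℤ.- y) (f≗g (suc m) B ℕ.≤-refl mono)
    (alternating-cong k (suc r) m (B ∘ suc) (mono ∘ suc)
      λ m′ B′ m′≤m → f≗g m′ B′ (ℕ.m≤n⇒m≤1+n m′≤m))

-- Integer sums and determinants

sumℤ-cong : ∀ {m} {f g : Fin m → ℤ} → (∀ i → f i ≡ g i) → sumℤ f ≡ sumℤ g
sumℤ-cong {zero}  f≗g = refl
sumℤ-cong {suc m} f≗g = cong₂ ℤ._+_ (f≗g zero) (sumℤ-cong (f≗g ∘ suc))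

sumℤ-zero : ∀ {m} {f : Fin m → ℤ} → (∀ i → f i ≡ 0ℤ) → sumℤ f ≡ 0ℤ
sumℤ-zero {zero}  f≗0 = refl
sumℤ-zero {suc m} f≗0 = cong₂ ℤ._+_ (f≗0 zero) (sumℤ-zero (f≗0 ∘ suc))

sumℤ-neg : ∀ {m} (f : Fin m → ℤ) → sumℤ (λ i → ℤ.- f i) ≡ ℤ.- sumℤ f
sumℤ-neg {zero}  f = refl
sumℤ-neg {suc m} f = trans (cong (λ x → (ℤ.- f zero) ℤ.+ x) (sumℤ-neg (f ∘ suc)))
                           (sym (ℤ.neg-distrib-+ (f zero) _))

det-cong : ∀ {m} {A A′ : Matrix m} → (∀ i j → A i j ≡ A′ i j) → det A ≡ det A′
det-cong {zero}  A≗A′ = refl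
det-cong {suc m} A≗A′ = sumℤ-cong λ c →
  cong₂ (λ x y → -1ℤ ℤ.^ toℕ c ℤ.* x ℤ.* y) (A≗A′ zero c)
        (det-cong λ i j → A≗A′ (suc i) (punchIn c j))

-- The term `c = 0` vanishes by its entry, every other one because its minor still contains the zero
-- column.
det-zero-column : ∀ {m} (A : Matrix (suc m)) → (∀ i → A i zero ≡ 0ℤ) → det A ≡ 0ℤ
det-zero-column A A₀≡0 = sumℤ-zero (term A A₀≡0)
  where
  term : ∀ {m} (A : Matrix (suc m)) → (∀ i → A i zero ≡ 0ℤ) → ∀ c →
         -1ℤ ℤ.^ toℕ c ℤ.* A zero c ℤ.* det (λ i j → A (suc i) (punchIn c j)) ≡ 0ℤ
  term A A₀≡0 zero rewrite A₀≡0 zero = refl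
  term {suc m} A A₀≡0 (suc c) =
    trans (cong (-1ℤ ℤ.^ suc (toℕ c) ℤ.* A zero (suc c) ℤ.*_)
                (det-zero-column (λ i j → A (suc i) (punchIn (suc c) j)) (A₀≡0 ∘ suc)))
          (ℤ.*-zeroʳ (-1ℤ ℤ.^ suc (toℕ c) ℤ.* A zero (suc c)))

-- For `c` other than 0 the minor keeps the first column without its 1, and so vanishes.
det-unit-column : ∀ {m} (A : Matrix (suc m)) → A zero zero ≡ 1ℤ → (∀ i → A (suc i) zero ≡ 0ℤ) →
                  det A ≡ det (λ i j → A (suc i) (suc j))
det-unit-column {zero}  A A₀₀≡1 A₀≡0 rewrite A₀₀≡1 = refl
det-unit-column {suc m} A A₀₀≡1 A₀≡0 rewrite A₀₀≡1 =
  trans (cong₂ ℤ._+_ (ℤ.*-identityˡ (det λ i j → A (suc i) (suc j)))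
          (sumℤ-zero λ c →
            trans (cong (-1ℤ ℤ.^ suc (toℕ c) ℤ.* A zero (suc c) ℤ.*_)
                        (det-zero-column (λ i j → A (suc i) (punchIn (suc c) j)) A₀≡0))
                  (ℤ.*-zeroʳ (-1ℤ ℤ.^ suc (toℕ c) ℤ.* A zero (suc c)))))
        (ℤ.+-identityʳ _)

-- h_{j-i+1}(b)
entry : ℕ → ℕ → ℕ → ℤ
entry b zero          j       = + h b (suc j)
entry b (suc zero)    zero    = 1ℤ
entry b (suc (suc i)) zero    = 0ℤ
entry b (suc i)       (suc j) = entry b i j

hessenberg : (m : ℕ) → (ℕ → ℕ) → Matrix m
hessenberg m B i j = entry (B (toℕ i)) (toℕ i) (toℕ j)

detH : Family
detH m B = det (hessenberg m B)

minor : ∀ m B → Fin (suc m) → ℤ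
minor m B c = det λ i j → hessenberg (suc m) B (suc i) (punchIn c j)

-- Column 0 survives the deletion; below row 0 it is the subdiagonal 1 followed by zeros, so it can
-- be split off.
minor-suc : ∀ m B c → minor (suc m) B (suc c) ≡ minor m (B ∘ suc) c
minor-suc m B c =
  det-unit-column (λ i j → hessenberg (suc (suc m)) B (suc i) (punchIn (suc c) j)) refl (λ _ → refl)

-- For `r = 1` and `b = B 0` the left side is the expansion of `detH (suc m) B`. A general `r` is
-- needed because splitting off the first term raises the degrees by one. The minor for `c = 0` is
-- `detH m (B ∘ suc)` by definition.
laplace : ∀ b r m B →
  sumℤ (λ c → -1ℤ ℤ.^ toℕ c ℤ.* + h b (r + toℕ c) ℤ.* minor m B c) ≡
  alternating b r detH m (B ∘ suc)
laplace b r zero    B rewrite ℕ.+-identityʳ r | ℤ.*-identityˡ (+ h b r) = ℤ.+-identityʳ _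
laplace b r (suc m) B = cong₂ ℤ._+_
  (cong (ℤ._* minor (suc m) B zero)
    (trans (ℤ.*-identityˡ (+ h b (r + 0))) (cong (λ x → + h b x) (ℕ.+-identityʳ r))))
  (begin
    sumℤ (λ c → -1ℤ ℤ.^ suc (toℕ c) ℤ.* + h b (r + suc (toℕ c)) ℤ.* minor (suc m) B (suc c))
      ≡⟨ sumℤ-cong (λ c → trans
           (cong₂ (λ x y → -1ℤ ℤ.^ suc (toℕ c) ℤ.* + h b x ℤ.* y)
                  (ℕ.+-suc r (toℕ c)) (minor-suc m B c))
           (regroup (-1ℤ ℤ.^ toℕ c) (+ h b (suc r + toℕ c)) (minor m (B ∘ suc) c))) ⟩
    sumℤ (λ c → ℤ.- (term c))
      ≡⟨ sumℤ-neg term ⟩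
    ℤ.- sumℤ term
      ≡⟨ cong ℤ.-_ (laplace b (suc r) m (B ∘ suc)) ⟩
    ℤ.- alternating b (suc r) detH m (λ i → B (suc (suc i))) ∎)
  where
  term : Fin (suc m) → ℤ
  term c = -1ℤ ℤ.^ toℕ c ℤ.* + h b (suc r + toℕ c) ℤ.* minor m (B ∘ suc) c
  regroup : ∀ x y z → -1ℤ ℤ.* x ℤ.* y ℤ.* z ≡ ℤ.- (x ℤ.* y ℤ.* z)
  regroup = ℤ-solve-∀

detH≡columns : ∀ m B → Monotone B → detH m B ≡ columnsℤ 1 m B
detH≡columns m = bounded m m ℕ.≤-refl
  where
  -- The expansion involves all tails of `B`, hence the induction on a bound `n` for `m`.
  bounded : ∀ n m → m ≤ n → ∀ B → Monotone B → detH m B ≡ columnsℤ 1 m B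
  bounded n       zero    m≤n       B mono = refl
  bounded (suc n) (suc m) (s≤s m≤n) B mono = begin
    detH (suc m) B
      ≡⟨ laplace (B 0) 1 m B ⟩
    alternating (B 0) 1 detH m (B ∘ suc)
      ≡⟨ alternating-cong (B 0) 1 m (B ∘ suc) (mono ∘ suc)
           (λ m′ B′ m′≤m → bounded n m′ (ℕ.≤-trans m′≤m m≤n) B′) ⟩
    alternating (B 0) 1 (columnsℤ 1) m (B ∘ suc)
      -- For `lo = 1` and `k = B 0`, the h₀ term of the vanishing alternating sum is the wanted
      -- count.
      ≡⟨ solveFor (columnsℤ 1 (suc m) B) _ (alternating-columns (B 0) 1 m B mono refl) ⟩
    columnsℤ 1 (suc m) B ∎
    where
    solveFor : ∀ x y → 1ℤ ℤ.* x ℤ.- y ≡ 0ℤ → y ≡ x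
    solveFor x y eq = trans (sym (ℤ.i-j≡0⇒i≡j (1ℤ ℤ.* x) y eq)) (ℤ.*-identityˡ x)

-- Both sides are constant along diagonals in form, so only the first row and the entries near the
-- first column are computed. Where the subtraction truncates, the lower index is at most 0 and the
-- upper one does not affect the value.
binom≡entry : ∀ b i j →
  binom ((suc j + b) ∸ suc i) (+ suc j ℤ.- (+ suc i ℤ.- 1ℤ)) ≡ entry b i j
binom≡entry b zero j rewrite ℕ.+-identityʳ j | ℕ.+-comm j b = refl
binom≡entry b (suc zero)    zero = refl
binom≡entry b (suc (suc i)) zero = refl
binom≡entry b (suc zero) (suc j) rewrite ℕ.+-comm j b = refl
binom≡entry b (suc (suc i)) (suc j) =
  trans (cong (binom ((suc j + b) ∸ suc (suc i))) (ℤ.[1+m]⊖[1+n]≡m⊖n (suc j) (suc i))) 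
        (binom≡entry b (suc i) j)

det-matrix-h : ∀ m (f : ℕ → ℕ → ℕ) B → Monotone B →
  (∀ i j → f (suc i) (suc j) ≡ (suc j + B i) ∸ suc i) →
  det (matrix m λ i j → binom (f i j) (+ j ℤ.- (+ i ℤ.- 1ℤ))) ≡ + columns 1 m B
det-matrix-h m f B mono f≡ = trans
  (det-cong {m} λ i j → trans
    (cong (λ x → binom x (+ suc (toℕ j) ℤ.- (+ suc (toℕ i) ℤ.- 1ℤ))) (f≡ (toℕ i) (toℕ j)))
    (binom≡entry (B (toℕ i)) (toℕ i) (toℕ j)))
  (detH≡columns m B mono)

-- Avoiding words with given multiplicities

sum-map-cong-∈ : (xs : List A) {f g : A → ℕ} → (∀ {x} → x ∈ xs → f x ≡ g x) →
                 sum (map f xs) ≡ sum (map g xs)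
sum-map-cong-∈ xs f≗g = cong sum (map-cong-local (All.tabulate f≗g))

length-concatMap : (f : A → List B) (xs : List A) →
                   length (concatMap f xs) ≡ sum (map (length ∘ f) xs)
length-concatMap f []       = refl
length-concatMap f (x ∷ xs) =
  trans (length-++ (f x)) (cong (_+_ (length (f x))) (length-concatMap f xs))

length-cartesianProduct : (xs : List A) (ys : List B) →
                          length (cartesianProduct xs ys) ≡ length xs * length ys
length-cartesianProduct []       ys = refl
length-cartesianProduct (x ∷ xs) ys = trans (length-++ (map (x ,_) ys))
  (cong₂ _+_ (length-map (x ,_) ys) (length-cartesianProduct xs ys))

unique-map : {f : A → B} {xs : List A} →
             (∀ {x y} → x ∈ xs → y ∈ xs → f x ≡ f y → x ≡ y) → Unique xs → Unique (map f xs)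
unique-map inj []         = []
unique-map inj (x∉ ∷ xs!) =
  All.map⁺ (All.tabulate λ y∈ fx≡fy → All.lookup x∉ y∈ (inj (here refl) (there y∈) fx≡fy))
  ∷ unique-map (λ x∈ y∈ → inj (there x∈) (there y∈)) xs!

-- `R` need not be inequality: the splits of a content will be told apart by their letters alone.
unique-concatMap : {R : Rel A ℓ} {f : A → List B} {xs : List A} →
  (∀ {x} → x ∈ xs → Unique (f x)) →
  (∀ {x y} → x ∈ xs → y ∈ xs → R x y → Disjoint (f x) (f y)) →
  AllPairs R xs → Unique (concatMap f xs)
unique-concatMap {R = R} {f} {xs} unique disjoint Rxs =
  Unique.concat⁺ (All.map⁺ (All.tabulate unique)) (AllPairs.map⁺ (pairs xs disjoint Rxs))
  where
  pairs : ∀ xs → (∀ {x y} → x ∈ xs → y ∈ xs → R x y → Disjoint (f x) (f y)) →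
          AllPairs R xs → AllPairs (λ x y → Disjoint (f x) (f y)) xs
  pairs []       disjoint []        = []
  pairs (x ∷ xs) disjoint (Rx ∷ Rxs) =
    All.tabulate (λ y∈ → disjoint (here refl) (there y∈) (All.lookup Rx y∈))
    ∷ pairs xs (λ x∈ y∈ → disjoint (there x∈) (there y∈)) Rxs

++-cancel-length : (xs xs′ : List A) {ys ys′ : List A} → length xs ≡ length xs′ →
                   xs ++ ys ≡ xs′ ++ ys′ → xs ≡ xs′ × ys ≡ ys′
++-cancel-length []       []         len eq = refl , eq
++-cancel-length (x ∷ xs) (x′ ∷ xs′) len eq
  with refl , eq′ ← ∷-injective eq
  with refl , ys≡ ← ++-cancel-length xs xs′ (ℕ.suc-injective len) eq′ = refl , ys≡

allPairs-++⁻ : {R : Rel A ℓ} (xs : List A) {ys : List A} →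
               AllPairs R (xs ++ ys) → AllPairs R xs × AllPairs R ys
allPairs-++⁻ []       Rys       = [] , Rys
allPairs-++⁻ (x ∷ xs) (Rx ∷ Rw) =
  let Rxs , Rys = allPairs-++⁻ xs Rw in All.++⁻ˡ xs Rx ∷ Rxs , Rys

-- Imposed on all pairs, the relation `Q y → Q z` says that the entries satisfying `Q` form a
-- suffix. The block condition behind a leading letter is encoded this way.
allPairs-late : {Q : Pred A ℓ} {xs : List A} → All Q xs → AllPairs (λ y z → Q y → Q z) xs
allPairs-late []         = []
allPairs-late (qx ∷ qxs) = All.map (λ qz _ → qz) qxs ∷ allPairs-late qxs

allPairs-early-late : {Q : Pred A ℓ} {xs ys : List A} →
  All (¬_ ∘ Q) xs → All Q ys → AllPairs (λ y z → Q y → Q z) (xs ++ ys)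
allPairs-early-late []           qys = allPairs-late qys
allPairs-early-late {xs = _ ∷ xs} {ys} (¬qx ∷ ¬qxs) qys =
  All.universal (λ _ qx → ⊥-elim (¬qx qx)) (xs ++ ys) ∷ allPairs-early-late ¬qxs qys

filter-early-late : {P Q : Pred A ℓ} (P? : Decidable P) (Q? : Decidable Q) →
  (∀ {x} → P x → ¬ Q x) → (∀ {x} → ¬ P x → Q x) →
  ∀ {xs} → AllPairs (λ y z → Q y → Q z) xs → filter P? xs ++ filter Q? xs ≡ xs
filter-early-late P? Q? P⇒¬Q ¬P⇒Q []  = refl
filter-early-late {Q = Q} P? Q? P⇒¬Q ¬P⇒Q {x ∷ xs} (Qx ∷ Qxs) with P? x
... | yes px rewrite filter-reject Q? {x} {xs} (P⇒¬Q px) =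
  cong (x ∷_) (filter-early-late P? Q? P⇒¬Q ¬P⇒Q Qxs)
... | no ¬px rewrite filter-accept Q? {x} {xs} (¬P⇒Q ¬px)
                   | filter-none P? {xs} (All.map (λ q p → P⇒¬Q p (q (¬P⇒Q ¬px))) Qx)
                   | filter-all Q? {xs} (All.map (λ q → q (¬P⇒Q ¬px)) Qx) = refl

-- (t , b) stands for b + 1 copies of the letter t.
Content : Set
Content = List (ℕ × ℕ)

expand : Content → List ℕ
expand []            = []
expand ((t , b) ∷ K) = t ∷ replicate b t ++ expand K

expand-++ : ∀ K L → expand (K ++ L) ≡ expand K ++ expand L
expand-++ []            L = refl
expand-++ ((t , b) ∷ K) L = cong (t ∷_)
  (trans (cong (replicate b t ++_) (expand-++ K L)) (sym (++-assoc (replicate b t) (expand K) (expand L))))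

all-expand : ∀ {P : Pred ℕ ℓ} {K} → All (P ∘ proj₁) K → All P (expand K)
all-expand []                             = []
all-expand {K = (t , b) ∷ K} (pt ∷ pK) = pt ∷ All.++⁺ (All.replicate⁺ b pt) (all-expand pK)

-- `(β , t , b , δ)` marks the entry `(t , b)` in `β ++ (t , b) ∷ δ`: `t` is chosen as leading
-- letter, and `β` holds the letters below it.
Split : Set
Split = Content × ℕ × ℕ × Content

splits : Content → List Split
splits []            = []
splits ((t , b) ∷ K) = ([] , t , b , K) ∷ map (map₁ ((t , b) ∷_)) (splits K)

letter : Split → ℕ
letter (_ , t , _) = t

-- Of `b + 1` copies of `t`, `b` remain; an entry cannot express zero copies, so it disappears for
-- `b = 0`.
removeOne : ℕ → ℕ → Content → Content
removeOne t zero    K = K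
removeOne t (suc b) K = (t , b) ∷ K

expand-removeOne : ∀ t b K → expand (removeOne t b K) ≡ replicate b t ++ expand K
expand-removeOne t zero    K = refl
expand-removeOne t (suc b) K = refl

∈-splits⁻ : ∀ {K β t b δ} → (β , t , b , δ) ∈ splits K → K ≡ β ++ (t , b) ∷ δ
∈-splits⁻ {(t , b) ∷ K} (here refl) = refl
∈-splits⁻ {(t , b) ∷ K} (there s∈) with ∈-map⁻ (map₁ ((t , b) ∷_)) s∈
... | _ , s′∈ , refl = cong ((t , b) ∷_) (∈-splits⁻ s′∈)

∈-expand⇒∈-splits : ∀ K {t} → t ∈ expand K → ∃[ β ] ∃[ b ] ∃[ δ ] (β , t , b , δ) ∈ splits K
∈-expand⇒∈-splits ((t , b) ∷ K) (here refl) = [] , b , K , here refl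
∈-expand⇒∈-splits ((t , b) ∷ K) (there s∈) with ∈-++⁻ (replicate b t) s∈
... | inj₁ s∈t rewrite All.lookup (All.replicate⁺ {P = _≡ t} b refl) s∈t = [] , b , K , here refl
... | inj₂ s∈K with ∈-expand⇒∈-splits K s∈K
... | β , b′ , δ , s∈ = (t , b) ∷ β , b′ , δ , there (∈-map⁺ (map₁ ((t , b) ∷_)) s∈)

all-letter-splits : ∀ {P : Pred ℕ ℓ} {K} → All (P ∘ proj₁) K → All (P ∘ letter) (splits K)
all-letter-splits []        = []
all-letter-splits (pt ∷ pK) = pt ∷ All.map⁺ (all-letter-splits pK)

split-↭ : ∀ β t b δ → expand (β ++ (t , b) ∷ δ) ↭ t ∷ expand (removeOne t b δ) ++ expand β
split-↭ β t b δ rewrite expand-++ β ((t , b) ∷ δ) | expand-removeOne t b δ =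
  ↭-trans (shift t (expand β) (replicate b t ++ expand δ)) (prep t (++-comm (expand β) _))

-- Which letters come first behind the leading letter t of a word: those not below t, or those below t.
data Side : Set where
  high low : Side

join : Side → List A → List A → List A
join high hi lo = hi ++ lo
join low  hi lo = lo ++ hi

join-↭ : ∀ s (hi lo : List A) → join s hi lo ↭ hi ++ lo
join-↭ high hi lo = ↭-refl
join-↭ low  hi lo = ++-comm lo hi

join-injective : ∀ s {hi hi′ lo lo′ : List A} → length hi ≡ length hi′ → length lo ≡ length lo′ →
                 join s hi lo ≡ join s hi′ lo′ → hi ≡ hi′ × lo ≡ lo′
join-injective high {hi} {hi′} hi≡ lo≡ eq = ++-cancel-length hi hi′ hi≡ eq
join-injective low {lo = lo} {lo′} hi≡ lo≡ eq
  with refl , refl ← ++-cancel-length lo lo′ lo≡ eq = refl , refl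

-- `n` is fuel, an upper bound for the length of the words: the parts of a split are not
-- structurally smaller contents.
words : Side → ℕ → Content → List (List ℕ)
branch : Side → ℕ → Split → List (List ℕ)
words s n       []        = [] ∷ []
words s zero    (_ ∷ _)   = []
words s (suc n) K@(_ ∷ _) = concatMap (branch s n) (splits K)
branch s n (β , t , b , δ) =
  map (λ (hi , lo) → t ∷ join s hi lo)
      (cartesianProduct (words s n (removeOne t b δ)) (words s n β))

-- Behind a leading `x`, the letter `y` belongs to the second of the two blocks.
Late : Rel ℕ Level.zero → Side → ℕ → ℕ → Set
Late _≺_ high x y = y ≺ x
Late _≺_ low  x y = ¬ (y ≺ x)

Compatible : Rel ℕ Level.zero → Side → ℕ → ℕ → ℕ → Set
Compatible _≺_ s x y z = Late _≺_ s x y → Late _≺_ s x z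

Triples : {A : Set} → (A → A → A → Set) → List A → Set
Triples T []      = ⊤
Triples T (x ∷ w) = AllPairs (T x) w × Triples T w

triples-++⁻ : ∀ {A : Set} {T : A → A → A → Set} xs {ys} →
              Triples T (xs ++ ys) → Triples T xs × Triples T ys
triples-++⁻ []       t        = tt , t
triples-++⁻ (x ∷ xs) (Tx , t) =
  let txs , tys = triples-++⁻ xs t in (proj₁ (allPairs-++⁻ xs Tx) , txs) , tys

triples-join⁻ : ∀ {A : Set} {T : A → A → A → Set} s hi lo →
                Triples T (join s hi lo) → Triples T hi × Triples T lo
triples-join⁻ high hi lo t = triples-++⁻ hi t
triples-join⁻ low  hi lo t = let tlo , thi = triples-++⁻ lo t in thi , tlo

Avoiding : Rel ℕ Level.zero → Side → List ℕ → Set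
Avoiding _≺_ s = Triples (Compatible _≺_ s)

Increasing : Rel ℕ Level.zero → Content → Set
Increasing _≺_ = AllPairs (λ u v → proj₁ u ≺ proj₁ v)

module _ (_≺_ : Rel ℕ Level.zero) (isSTO : IsStrictTotalOrder _≡_ _≺_) where

  open IsStrictTotalOrder isSTO using (_<?_; compare; irrefl; asym) renaming (trans to ≺-trans)

  ≺⊁-trans : ∀ {x y t} → y ≺ t → ¬ x ≺ t → y ≺ x
  ≺⊁-trans {x} {y} {t} y≺t x⊀t with compare t x
  ... | tri< t≺x _ _    = ≺-trans y≺t t≺x
  ... | tri≈ _ refl _   = y≺t
  ... | tri> _ _ x≺t    = ⊥-elim (x⊀t x≺t)

  -- A triple reaching from `xs` into `ys` ends in a letter that is late for its first one, so its
  -- condition holds whatever lies between.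
  avoiding-++⁺ : ∀ s {xs ys} → Avoiding _≺_ s xs → Avoiding _≺_ s ys →
                 All (λ x → All (Late _≺_ s x) ys) xs → Avoiding _≺_ s (xs ++ ys)
  avoiding-++⁺ s {[]}     _           Ays _              = Ays
  avoiding-++⁺ s {x ∷ xs} (Cxs , Axs) Ays (late ∷ lates) =
    AllPairs.++⁺ Cxs (allPairs-late late) (All.universal (λ _ → All.map (λ q _ → q) late) xs)
    , avoiding-++⁺ s Axs Ays lates

  -- Comparison through `t` shows that the letters of the second block are late for every letter of
  -- the first.
  avoiding-∷-join : ∀ s t hi lo → All (λ x → ¬ x ≺ t) hi → All (_≺ t) lo →
                    Avoiding _≺_ s hi → Avoiding _≺_ s lo → Avoiding _≺_ s (t ∷ join s hi lo)
  avoiding-∷-join high t hi lo hi⊀t lo≺t Ahi Alo =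
    allPairs-early-late hi⊀t lo≺t ,
    avoiding-++⁺ high Ahi Alo (All.map (λ x⊀t → All.map (λ y≺t → ≺⊁-trans y≺t x⊀t) lo≺t) hi⊀t)
  avoiding-∷-join low t hi lo hi⊀t lo≺t Ahi Alo =
    allPairs-early-late (All.map (λ y≺t y⊀t → y⊀t y≺t) lo≺t) hi⊀t ,
    avoiding-++⁺ low Alo Ahi
      (All.map (λ x≺t → All.map (λ y⊀t y≺x → y⊀t (≺-trans y≺x x≺t)) hi⊀t) lo≺t)

  -- Compatibility with `t` makes the late letters a suffix, so separating the two sides of `t`
  -- moves no letter.
  join-filter : ∀ s t w → AllPairs (Compatible _≺_ s t) w →
                join s (filter (λ x → ¬? (x <? t)) w) (filter (_<? t) w) ≡ w
  join-filter high t w C = filter-early-late (λ x → ¬? (x <? t)) (_<? t) (λ ¬p → ¬p) stable C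
    where
    stable : ∀ {x} → ¬ ¬ x ≺ t → x ≺ t
    stable {x} ¬¬p with x <? t
    ... | yes p = p
    ... | no ¬p = ⊥-elim (¬¬p ¬p)
  join-filter low t w C = filter-early-late (_<? t) (λ x → ¬? (x <? t)) (λ p ¬p → ¬p p) (λ ¬p → ¬p) C

  record SplitParts (β : Content) (t b : ℕ) (δ : Content) : Set where
    field
      increasing-lo : Increasing _≺_ β
      increasing-hi : Increasing _≺_ (removeOne t b δ)
      lo-≺          : All (_≺ t) (expand β)
      hi-⊀          : All (λ x → ¬ x ≺ t) (expand (removeOne t b δ))

  splitParts : ∀ β {t b δ} → Increasing _≺_ (β ++ (t , b) ∷ δ) → SplitParts β t b δ
  splitParts [] {t} {b} {δ} (t≺δ ∷ Iδ) = record
    { increasing-lo = []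
    ; increasing-hi = inc b
    ; lo-≺          = []
    ; hi-⊀          = subst (All _) (sym (expand-removeOne t b δ))
        (All.++⁺ (All.replicate⁺ b (irrefl refl)) (all-expand (All.map asym t≺δ)))
    }
    where
    inc : ∀ b → Increasing _≺_ (removeOne t b δ)
    inc zero    = Iδ
    inc (suc b) = t≺δ ∷ Iδ
  splitParts ((u , c) ∷ β) (u≺ ∷ I) = record
    { increasing-lo = All.++⁻ˡ β u≺ ∷ increasing-lo
    ; increasing-hi = increasing-hi
    ; lo-≺          = u≺t ∷ All.++⁺ (All.replicate⁺ c u≺t) lo-≺
    ; hi-⊀          = hi-⊀
    }
    where
    open SplitParts (splitParts β I)
    u≺t = All.head (All.++⁻ʳ β u≺)

  words-sound : ∀ s n K {w} → Increasing _≺_ K → w ∈ words s n K → w ↭ expand K × Avoiding _≺_ s w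
  words-sound s n       []        I (here refl) = ↭-refl , tt
  words-sound s (suc n) K@(_ ∷ _) I w∈ =
    branches (splits K) (λ s∈ → s∈) (∈-concatMap⁻ (branch s n) w∈)
    where
    sound-branch : ∀ {β t b δ w} → (β , t , b , δ) ∈ splits K → w ∈ branch s n (β , t , b , δ) →
                   w ↭ expand K × Avoiding _≺_ s w
    sound-branch {β} {t} {b} {δ} s∈ w∈
      with (hi , lo) , hl∈ , refl ← ∈-map⁻ (λ (hi , lo) → t ∷ join s hi lo) w∈
      with hi∈ , lo∈ ← ∈-cartesianProduct⁻ (words s n (removeOne t b δ)) (words s n β) hl∈ =
      ↭-trans (prep t (↭-trans (join-↭ s hi lo) (++⁺ hi↭ lo↭)))
              (↭-sym (↭-trans (↭-reflexive (cong expand K≡)) (split-↭ β t b δ))) ,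
      avoiding-∷-join s t hi lo (All-resp-↭ (↭-sym hi↭) hi-⊀) (All-resp-↭ (↭-sym lo↭) lo-≺) Ahi Alo
      where
      K≡ = ∈-splits⁻ {K} s∈
      open SplitParts (splitParts β (subst (Increasing _≺_) K≡ I))
      hi-sound = words-sound s n (removeOne t b δ) increasing-hi hi∈
      lo-sound = words-sound s n β increasing-lo lo∈
      hi↭ = proj₁ hi-sound
      Ahi = proj₂ hi-sound
      lo↭ = proj₁ lo-sound
      Alo = proj₂ lo-sound
    branches : ∀ {w} S → (∀ {x} → x ∈ S → x ∈ splits K) → Any ((w ∈_) ∘ branch s n) S →
               w ↭ expand K × Avoiding _≺_ s w
    branches (_ ∷ S) S⊆ (here w∈)  = sound-branch (S⊆ (here refl)) w∈
    branches (_ ∷ S) S⊆ (there w∈) = branches S (S⊆ ∘ there) w∈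

  words-complete : ∀ s n K {w} → Increasing _≺_ K → length w ≤ n →
                   w ↭ expand K → Avoiding _≺_ s w → w ∈ words s n K
  words-complete s n [] I w≤n w↭ A rewrite ↭-empty-inv w↭ = here refl
  words-complete s n (_ ∷ _) {[]} I w≤n w↭ A with () ← ↭-length w↭
  words-complete s (suc n) K@(_ ∷ _) {t ∷ w} I (s≤s w≤n) w↭ (C , A)
    with β , b , δ , s∈ ← ∈-expand⇒∈-splits K (∈-resp-↭ w↭ (here refl)) =
    ∈-concat⁺′ (subst (_∈ branch s n (β , t , b , δ)) (cong (t ∷_) (join-filter s t w C))
                 (∈-map⁺ (λ (hi , lo) → t ∷ join s hi lo) (∈-cartesianProduct⁺ hi∈ lo∈)))
               (∈-map⁺ (branch s n) s∈)
    where
    K≡ = ∈-splits⁻ {K} s∈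
    open SplitParts (splitParts β (subst (Increasing _≺_) K≡ I))
    E = expand (removeOne t b δ)
    w↭E : w ↭ E ++ expand β
    w↭E = drop-∷ (↭-trans w↭ (↭-trans (↭-reflexive (cong expand K≡)) (split-↭ β t b δ)))
    hi lo : List ℕ
    hi = filter (λ x → ¬? (x <? t)) w
    lo = filter (_<? t) w
    -- Since `K` is increasing, comparison with `t` recovers the two parts of the split from the
    -- letters of `w`.
    hi↭ : hi ↭ E
    hi↭ = ↭-trans (filter-↭ (λ x → ¬? (x <? t)) w↭E) (↭-reflexive
      (trans (filter-++ (λ x → ¬? (x <? t)) E (expand β))
        (trans (cong₂ _++_ (filter-all (λ x → ¬? (x <? t)) hi-⊀)
                           (filter-none (λ x → ¬? (x <? t)) (All.map (λ p ¬p → ¬p p) lo-≺)))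
               (++-identityʳ E))))
    lo↭ : lo ↭ expand β
    lo↭ = ↭-trans (filter-↭ (_<? t) w↭E) (↭-reflexive
      (trans (filter-++ (_<? t) E (expand β))
        (cong₂ _++_ (filter-none (_<? t) hi-⊀) (filter-all (_<? t) lo-≺))))
    A′ = triples-join⁻ s hi lo (subst (Avoiding _≺_ s) (sym (join-filter s t w C)) A)
    hi∈ = words-complete s n (removeOne t b δ) increasing-hi
            (ℕ.≤-trans (length-filter (λ x → ¬? (x <? t)) w) w≤n) hi↭ (proj₁ A′)
    lo∈ = words-complete s n β increasing-lo
            (ℕ.≤-trans (length-filter (_<? t) w) w≤n) lo↭ (proj₂ A′)

  -- Words from different branches differ in the first letter. Within a branch the content fixes the
  -- lengths of both blocks, so `join` can be undone.
  words-unique : ∀ s n K → Increasing _≺_ K → Unique (words s n K)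
  words-unique s n       []        I = [] ∷ []
  words-unique s zero    (_ ∷ _)   I = []
  words-unique s (suc n) K@(_ ∷ _) I =
    unique-concatMap {R = λ u v → letter u ≢ letter v} branch-unique disjoint (letters-distinct K I)
    where
    branch-unique : ∀ {x} → x ∈ splits K → Unique (branch s n x)
    branch-unique {β , t , b , δ} s∈ = unique-map injective
      (Unique.cartesianProduct⁺ (words-unique s n (removeOne t b δ) increasing-hi)
                                (words-unique s n β increasing-lo))
      where
      open SplitParts (splitParts β (subst (Increasing _≺_) (∈-splits⁻ {K} s∈) I))
      words-length : ∀ {L v w} → Increasing _≺_ L → v ∈ words s n L → w ∈ words s n L →
                     length v ≡ length w
      words-length IL v∈ w∈ = trans (↭-length (proj₁ (words-sound s n _ IL v∈)))
                                    (sym (↭-length (proj₁ (words-sound s n _ IL w∈))))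
      injective : ∀ {x y} → x ∈ cartesianProduct (words s n (removeOne t b δ)) (words s n β) →
                  y ∈ cartesianProduct (words s n (removeOne t b δ)) (words s n β) →
                  t ∷ join s (proj₁ x) (proj₂ x) ≡ t ∷ join s (proj₁ y) (proj₂ y) → x ≡ y
      injective {hi , lo} {hi′ , lo′} x∈ y∈ eq
        with hi∈ , lo∈ ← ∈-cartesianProduct⁻ (words s n (removeOne t b δ)) (words s n β) x∈
        with hi′∈ , lo′∈ ← ∈-cartesianProduct⁻ (words s n (removeOne t b δ)) (words s n β) y∈
        with refl , refl ← join-injective s (words-length increasing-hi hi∈ hi′∈)
                             (words-length increasing-lo lo∈ lo′∈) (∷-injectiveʳ eq) = refl
    disjoint : ∀ {x y} → x ∈ splits K → y ∈ splits K → letter x ≢ letter y →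
               Disjoint (branch s n x) (branch s n y)
    disjoint _ _ x≢y (w∈x , w∈y)
      with _ , _ , refl ← ∈-map⁻ _ w∈x
      with _ , _ , eq ← ∈-map⁻ _ w∈y = x≢y (∷-injectiveˡ eq)
    letters-distinct : ∀ K → Increasing _≺_ K → AllPairs (λ u v → letter u ≢ letter v) (splits K)
    letters-distinct []      []       = []
    letters-distinct (_ ∷ K) (t≺ ∷ I) =
      All.map⁺ (All.map (λ t≺u t≡u → irrefl t≡u t≺u) (all-letter-splits t≺))
      ∷ AllPairs.map⁺ (letters-distinct K I)

-- Enumerating contents of parking functions

∑<-cong-< : ∀ n {f g : ℕ → ℕ} → (∀ i → i < n → f i ≡ g i) → ∑< n f ≡ ∑< n g
∑<-cong-< zero    f≗g = refl
∑<-cong-< (suc n) f≗g = cong₂ _+_ (f≗g 0 (s≤s z≤n)) (∑<-cong-< n λ i i<n → f≗g (suc i) (s≤s i<n))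

∑<-+ : ∀ n (f g : ℕ → ℕ) → ∑< n (λ i → f i + g i) ≡ ∑< n f + ∑< n g
∑<-+ zero    f g = refl
∑<-+ (suc n) f g = trans (cong (_+_ (f 0 + g 0)) (∑<-+ n (f ∘ suc) (g ∘ suc)))
                         (interchange (f 0) (g 0) (∑< n (f ∘ suc)) (∑< n (g ∘ suc)))
  where
  interchange : ∀ a b c d → (a + b) + (c + d) ≡ (a + c) + (b + d)
  interchange = solve-∀

∑<-zero : ∀ n → ∑< n (λ _ → 0) ≡ 0
∑<-zero zero    = refl
∑<-zero (suc n) = ∑<-zero n

∑<-*ʳ : ∀ n (f : ℕ → ℕ) k → ∑< n (λ i → f i * k) ≡ ∑< n f * k
∑<-*ʳ zero    f k = refl
∑<-*ʳ (suc n) f k = trans (cong (_+_ (f 0 * k)) (∑<-*ʳ n (f ∘ suc) k))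
                          (sym (ℕ.*-distribʳ-+ k (f 0) (∑< n (f ∘ suc))))

∑<-reverse : ∀ n (f : ℕ → ℕ) → ∑< n f ≡ ∑< n (λ i → f (n ∸ suc i))
∑<-reverse n f = begin
  sum (applyUpTo f n)                    ≡⟨ sum-↭ (↭-reverse (applyUpTo f n)) ⟨
  sum (reverse (applyUpTo f n))          ≡⟨ cong sum (reverse-applyUpTo f n) ⟩
  sum (applyDownFrom f n)                ≡⟨ cong sum (downFrom≡upTo n) ⟩
  sum (applyUpTo (λ i → f (n ∸ suc i)) n) ∎
  where
  downFrom≡upTo : ∀ n → applyDownFrom f n ≡ applyUpTo (λ i → f (n ∸ suc i)) n
  downFrom≡upTo zero    = refl
  downFrom≡upTo (suc n) = cong (f n ∷_) (downFrom≡upTo n)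

∑<-sum-swap : ∀ n (xs : List A) (f : ℕ → A → ℕ) →
              ∑< n (λ i → sum (map (f i) xs)) ≡ sum (map (λ x → ∑< n (λ i → f i x)) xs)
∑<-sum-swap n []       f = ∑<-zero n
∑<-sum-swap n (x ∷ xs) f = trans (∑<-+ n (λ i → f i x) (λ i → sum (map (f i) xs)))
                                 (cong (_+_ (∑< n (λ i → f i x))) (∑<-sum-swap n xs f))

-- Counting avoiding words by insertions

sizes : Content → List ℕ
sizes = map (suc ∘ proj₂)

-- The maximal letter of a word avoiding 213 is inserted as one contiguous block somewhere in the
-- longest weakly increasing prefix (of length x), at a position g, which leaves a prefix of
-- length g + (number of copies).
insertions : ℕ → Content → ℕ
insertions x []            = 1
insertions x ((t , b) ∷ K) = ∑< (suc x) λ g → insertions (g + suc b) K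

-- Consider the last block inserted at position 0. If there is none, lowering all positions by one
-- leaves `insertions x K`. If it is `(t , b)`, the blocks of `β` before it are free, and those of
-- `δ` after it use only nonzero positions, starting from a prefix of length `b + 1`.
insertions-suc : ∀ x K → insertions (suc x) K ≡
  insertions x K + sum (map (λ (β , t , b , δ) → insertions (suc x) β * insertions b δ) (splits K))
insertions-suc x []            = refl
insertions-suc x ((t , a) ∷ K) = begin
  ∑< (suc (suc x)) (λ g → insertions (g + suc a) K)
    ≡⟨ ∑<-cong (suc (suc x)) (λ g → trans (cong (λ y → insertions y K) (ℕ.+-suc g a))
                                           (insertions-suc (g + a) K)) ⟩
  ∑< (suc (suc x)) (λ g → insertions (g + a) K + sum (map (term g) (splits K)))
    ≡⟨ ∑<-+ (suc (suc x)) (λ g → insertions (g + a) K) (λ g → sum (map (term g) (splits K))) ⟩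
  -- The term `g = 0`, split off here, is the case that the block of `t` is itself the last one at
  -- position 0.
  (insertions a K + ∑< (suc x) (λ g → insertions (suc g + a) K)) +
  ∑< (suc (suc x)) (λ g → sum (map (term g) (splits K)))
    ≡⟨ cong₂ (λ y z → (insertions a K + y) + z)
         (∑<-cong (suc x) λ g → cong (λ y → insertions y K) (sym (ℕ.+-suc g a)))
         (trans (∑<-sum-swap (suc (suc x)) (splits K) term)
                (cong sum (map-cong collect (splits K)))) ⟩
  (insertions a K + insertions x ((t , a) ∷ K)) + sum (map total (splits K))
    ≡⟨ regroup (insertions a K) (insertions x ((t , a) ∷ K)) (sum (map total (splits K))) ⟩
  insertions x ((t , a) ∷ K) + (1 * insertions a K + sum (map total (splits K)))
    ≡⟨ cong (λ L → insertions x ((t , a) ∷ K) + (1 * insertions a K + sum L))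
         (map-∘ (splits K)) ⟩
  insertions x ((t , a) ∷ K) + sum (map _ (splits ((t , a) ∷ K))) ∎
  where
  term : ℕ → Split → ℕ
  term g (β , _ , b , δ) = insertions (suc (g + a)) β * insertions b δ
  total : Split → ℕ
  total (β , _ , b , δ) = insertions (suc x) ((t , a) ∷ β) * insertions b δ
  collect : ∀ s → ∑< (suc (suc x)) (λ g → term g s) ≡ total s
  collect (β , _ , b , δ) =
    trans (∑<-*ʳ (suc (suc x)) (λ g → insertions (suc (g + a)) β) (insertions b δ))
          (cong (_* insertions b δ) (∑<-cong (suc (suc x)) λ g →
            cong (λ y → insertions y β) (sym (ℕ.+-suc g a))))
  regroup : ∀ a b c → (a + b) + c ≡ b + (1 * a + c)
  regroup = solve-∀

-- A block enters the empty word in one way only and leaves a prefix of its own length.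
insertions-removeOne : ∀ t b K → insertions 0 (removeOne t b K) ≡ insertions b K
insertions-removeOne t zero    K = refl
insertions-removeOne t (suc b) K = ℕ.+-identityʳ _

-- The branches match the summands of `insertions-suc` at `x = a`, as the first block makes a prefix
-- of length `a + 1`. The count does not depend on `s`, whence the equality for the two patterns of
-- a pair.
length-words : ∀ s n K → length (expand K) ≤ n → length (words s n K) ≡ insertions 0 K
length-words s n       []              _  = refl
length-words s (suc n) K₀@((t , a) ∷ K) (s≤s size≤n) = begin
  length (concatMap (branch s n) (splits K₀))
    ≡⟨ length-concatMap (branch s n) (splits K₀) ⟩
  sum (map (length ∘ branch s n) (splits K₀))
    ≡⟨ sum-map-cong-∈ (splits K₀) length-branch ⟩
  -- Except in the split with empty `β`, the lower part begins with `(t , a)`, and its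
  -- `insertions 0` is `insertions (suc a)` of the rest.
  insertions a K * 1 + sum (map weight (map (map₁ ((t , a) ∷_)) (splits K)))
    ≡⟨ cong₂ (λ x L → x + sum L) (ℕ.*-identityʳ (insertions a K)) (sym (map-∘ (splits K))) ⟩
  insertions a K + sum (map (λ s → weight (map₁ ((t , a) ∷_) s)) (splits K))
    ≡⟨ cong (λ L → insertions a K + sum L) (map-cong (λ (β , _ , b , δ) →
         trans (ℕ.*-comm (insertions b δ) (insertions (suc a) β + 0))
               (cong (_* insertions b δ) (ℕ.+-identityʳ (insertions (suc a) β)))) (splits K)) ⟩
  insertions a K + sum (map (λ (β , _ , b , δ) → insertions (suc a) β * insertions b δ) (splits K))
    ≡⟨ insertions-suc a K ⟨
  insertions (suc a) K
    ≡⟨ ℕ.+-identityʳ _ ⟨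
  insertions (suc a) K + 0 ∎
  where
  weight : Split → ℕ
  weight (β , _ , b , δ) = insertions b δ * insertions 0 β
  length-branch : ∀ {x} → x ∈ splits K₀ → length (branch s n x) ≡ weight x
  length-branch {β , u , b , δ} s∈ = begin
    length (branch s n (β , u , b , δ))
      ≡⟨ length-map (λ (hi , lo) → u ∷ join s hi lo)
           (cartesianProduct (words s n (removeOne u b δ)) (words s n β)) ⟩
    length (cartesianProduct (words s n (removeOne u b δ)) (words s n β))
      ≡⟨ length-cartesianProduct (words s n (removeOne u b δ)) (words s n β) ⟩
    length (words s n (removeOne u b δ)) * length (words s n β)
      ≡⟨ cong₂ _*_ (trans (length-words s n (removeOne u b δ) hi≤n) (insertions-removeOne u b δ))
                   (length-words s n β lo≤n) ⟩
    insertions b δ * insertions 0 β ∎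
    where
    parts≤n : length (expand (removeOne u b δ)) + length (expand β) ≤ n
    parts≤n = ℕ.≤-trans (ℕ.≤-reflexive (ℕ.suc-injective (trans
      (cong suc (sym (length-++ (expand (removeOne u b δ)))))
      (trans (sym (↭-length (split-↭ β u b δ))) (cong (length ∘ expand) (sym (∈-splits⁻ {K₀} s∈))))))) size≤n
    hi≤n = ℕ.m+n≤o⇒m≤o (length (expand (removeOne u b δ))) parts≤n
    lo≤n = ℕ.m+n≤o⇒n≤o (length (expand (removeOne u b δ))) parts≤n

-- A path with positions gᵢ corresponds to the sequence tᵢ = (letters so far) - gᵢ + i.
insertions≡columns : ∀ lo x K →
  insertions x K ≡ columns lo (length K) (λ i → (lo + x) + (prefixSum (sizes K) i + i))
insertions≡columns lo x []            = refl
insertions≡columns lo x ((t , b) ∷ K) = begin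
  ∑< (suc x) (λ g → insertions (g + suc b) K)
    -- The position `g = x - i` becomes the value `lo + i`, hence the reversal.
    ≡⟨ ∑<-reverse (suc x) (λ g → insertions (g + suc b) K) ⟩
  ∑< (suc x) (λ i → insertions ((x ∸ i) + suc b) K)
    ≡⟨ ∑<-cong-< (suc x) (λ i i≤x → trans (insertions≡columns (suc (lo + i)) ((x ∸ i) + suc b) K)
         (columns-cong (suc (lo + i)) (length K) λ j _ →
           trans (cong (λ y → y + (prefixSum (sizes K) j + j)) (total i (ℕ.≤-pred i≤x)))
                 (regroup lo x b (prefixSum (sizes K) j) j))) ⟩
  ∑< (suc x) (λ i → columns (suc (lo + i)) (length K) (bound ∘ suc))
    ≡⟨ cong (λ m → ∑< m (λ i → columns (suc (lo + i)) (length K) (bound ∘ suc))) range ⟩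
  ∑< (suc ((lo + x) + 0) ∸ lo) (λ i → columns (suc (lo + i)) (length K) (bound ∘ suc)) ∎
  where
  bound : ℕ → ℕ
  bound i = (lo + x) + (prefixSum (sizes ((t , b) ∷ K)) i + i)
  range : suc x ≡ suc ((lo + x) + 0) ∸ lo
  range = trans (sym (ℕ.m+n∸m≡n lo (suc x)))
                (cong (_∸ lo) (trans (ℕ.+-suc lo x) (cong suc (sym (ℕ.+-identityʳ (lo + x))))))
  total : ∀ i → i ≤ x → suc (lo + i) + ((x ∸ i) + suc b) ≡ suc (lo + x) + suc b
  total i i≤x = trans (assoc lo i (x ∸ i) b) (cong (λ y → suc (lo + y) + suc b) (ℕ.m+[n∸m]≡n i≤x))
    where
    assoc : ∀ l i d b → suc (l + i) + (d + suc b) ≡ suc (l + (i + d)) + suc b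
    assoc = solve-∀
  regroup : ∀ l x b p j → (suc (l + x) + suc b) + (p + j) ≡ (l + x) + ((suc b + p) + suc j)
  regroup = solve-∀

-- The first block has a single position, which saves one column: the determinants have order
-- `k - 1`.
insertions-0 : ∀ K → insertions 0 K ≡
               columns 1 (length K ∸ 1) (λ i → prefixSum (sizes K) (suc i) + suc i)
insertions-0 []            = refl
insertions-0 ((t , b) ∷ K) = trans (ℕ.+-identityʳ _) (trans (insertions≡columns 1 (suc b) K)
  (columns-cong 1 (length K) λ i _ → regroup b (prefixSum (sizes K) i) i))
  where
  regroup : ∀ b p i → (1 + suc b) + (p + i) ≡ (suc b + p) + suc i
  regroup = solve-∀

-- The determinants of the theorem as counts of sequences

prefixSum-mono : ∀ α i → prefixSum α i ≤ prefixSum α (suc i)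
prefixSum-mono []      zero    = z≤n
prefixSum-mono []      (suc i) = z≤n
prefixSum-mono (a ∷ α) zero    = z≤n
prefixSum-mono (a ∷ α) (suc i) = ℕ.+-monoʳ-≤ a (prefixSum-mono α i)

-- The summand `suc i` in the bounds cancels the subtraction of the row index in `det-matrix-h`.
det-shifted : ∀ m α → det (matrix m λ i j → binom (j + prefixSum α i) (+ j ℤ.- (+ i ℤ.- 1ℤ))) ≡
              + columns 1 m (λ i → prefixSum α (suc i) + suc i)
det-shifted m α = det-matrix-h m (λ i j → j + prefixSum α i) (λ i → prefixSum α (suc i) + suc i)
  (λ i → ℕ.+-mono-≤ (prefixSum-mono α (suc i)) (ℕ.n≤1+n (suc i)))
  (λ i j → sym (trans (cong (_∸ suc i) (sym (ℕ.+-assoc (suc j) (prefixSum α (suc i)) (suc i))))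
                      (ℕ.m+n∸n≡m (suc j + prefixSum α (suc i)) (suc i))))

det-matrixA : ∀ α → det (matrixA α) ≡ + columns 1 (length α ∸ 1) (λ i → prefixSum α (suc i))
det-matrixA α = det-matrix-h (length α ∸ 1) (λ i j → (j + prefixSum α i) ∸ i)
  (λ i → prefixSum α (suc i)) (λ i → prefixSum-mono α (suc i)) (λ i j → refl)

-- Compositions and the contents of parking functions

∈-compositions⁻ : ∀ n {α} → α ∈ compositions n → All (1 ≤_) α × sum α ≡ n
∈-compositions⁻ zero    (here refl) = [] , refl
∈-compositions⁻ (suc n) α∈ with find (∈-concatMap⁻ _ {xs = compositions n} α∈)
... | []    , β∈ , here refl with _ , refl ← ∈-compositions⁻ n β∈ = s≤s z≤n ∷ [] , refl
... | b ∷ β , β∈ , here refl with β≥1 , refl ← ∈-compositions⁻ n β∈ = s≤s z≤n ∷ β≥1 , refl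
... | b ∷ β , β∈ , there (here refl) with b≥1 ∷ β≥1 , refl ← ∈-compositions⁻ n β∈ =
  ℕ.m≤n⇒m≤1+n b≥1 ∷ β≥1 , refl

∈-compositions⁺ : ∀ {α} n → All (1 ≤_) α → sum α ≡ n → α ∈ compositions n
∈-compositions⁺ zero    []        eq = here refl
∈-compositions⁺ {suc _ ∷ _} zero (_ ∷ _) ()
∈-compositions⁺ {suc zero ∷ []} (suc zero) (_ ∷ α≥1) eq = here refl
∈-compositions⁺ {suc zero ∷ a ∷ α} (suc n) (_ ∷ α≥1) eq =
  ∈-concat⁺′ (here refl) (∈-map⁺ _ (∈-compositions⁺ n α≥1 (ℕ.suc-injective eq)))
∈-compositions⁺ {suc (suc a) ∷ α} (suc n) (_ ∷ α≥1) eq =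
  ∈-concat⁺′ (there (here refl)) (∈-map⁺ _ (∈-compositions⁺ n (s≤s z≤n ∷ α≥1) (ℕ.suc-injective eq)))

compositions-unique : ∀ n → Unique (compositions n)
compositions-unique zero    = [] ∷ []
compositions-unique (suc n) =
  unique-concatMap {xs = compositions n} unique-extend disjoint-extend (compositions-unique n)
  where
  unique-extend : ∀ {β} → β ∈ compositions n → Unique _
  unique-extend {[]}    β∈ = [] ∷ []
  unique-extend {b ∷ β} β∈ = ((λ ()) ∷ []) ∷ [] ∷ []
  -- A prepended part 1 can agree with an increased first part only if that part was 0.
  0∷∉ : ∀ {α} → ¬ 0 ∷ α ∈ compositions n
  0∷∉ α∈ with () ∷ _ , _ ← ∈-compositions⁻ n α∈
  disjoint-extend : ∀ {β γ} → β ∈ compositions n → γ ∈ compositions n → β ≢ γ → Disjoint _ _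
  disjoint-extend {[]}    {[]}    β∈ γ∈ β≢γ _                       = β≢γ refl
  disjoint-extend {b ∷ β} {c ∷ γ} β∈ γ∈ β≢γ (here refl , here refl) = β≢γ refl
  disjoint-extend {b ∷ β} {c ∷ γ} β∈ γ∈ β≢γ (there (here refl) , there (here refl)) = β≢γ refl
  disjoint-extend {[]}    {c ∷ γ} β∈ γ∈ _ (here refl , there (here refl)) = 0∷∉ γ∈
  disjoint-extend {b ∷ β} {[]}    β∈ γ∈ _ (there (here refl) , here refl) = 0∷∉ β∈
  disjoint-extend {b ∷ β} {c ∷ γ} β∈ γ∈ _ (here refl , there (here refl)) = 0∷∉ γ∈
  disjoint-extend {b ∷ β} {c ∷ γ} β∈ γ∈ _ (there (here refl) , here refl) = 0∷∉ β∈

-- Contents whose letters t₀ < t₁ < ⋯ satisfy lo ≤ t₀ and tᵢ ≤ e + α₁ + ⋯ + αᵢ. For lo = e = 0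
-- these are the contents of parking functions, as tᵢ first occurs at position α₁ + ⋯ + αᵢ of the
-- increasing rearrangement.
contents : ℕ → ℕ → List ℕ → List Content
contents lo e []      = [] ∷ []
contents lo e (a ∷ α) = concatMap
  (λ t → map ((t , pred a) ∷_) (contents (suc t) (e + a) α))
  (applyUpTo (_+_ lo) (suc e ∸ lo))

-- The condition of `contents`, read off the content itself. Starting from `e = 0`, `e` counts the
-- letters placed so far, so it is the zero-based position of the first `t`.
Fits : ℕ → ℕ → Content → Set
Fits lo e []            = ⊤
Fits lo e ((t , b) ∷ K) = lo ≤ t × t ≤ e × Fits (suc t) (e + suc b) K

length-contents : ∀ lo e α → length (contents lo e α) ≡ columns lo (length α) (λ i → e + prefixSum α i)
length-contents lo e []      = refl
length-contents lo e (a ∷ α) = begin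
  length (concatMap f (applyUpTo (_+_ lo) (suc e ∸ lo)))
    ≡⟨ length-concatMap f (applyUpTo (_+_ lo) (suc e ∸ lo)) ⟩
  sum (map (length ∘ f) (applyUpTo (_+_ lo) (suc e ∸ lo)))
    ≡⟨ cong sum (map-applyUpTo (_+_ lo) (length ∘ f) (suc e ∸ lo)) ⟩
  ∑< (suc e ∸ lo) (λ i → length (f (lo + i)))
    ≡⟨ ∑<-cong (suc e ∸ lo) (λ i → trans
         (length-map ((lo + i , pred a) ∷_) (contents (suc (lo + i)) (e + a) α))
         (trans (length-contents (suc (lo + i)) (e + a) α)
           (columns-cong (suc (lo + i)) (length α) λ j _ → ℕ.+-assoc e a (prefixSum α j)))) ⟩
  ∑< (suc e ∸ lo) (λ i → columns (suc (lo + i)) (length α) (λ j → e + (a + prefixSum α j)))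
    ≡⟨ cong (λ x → ∑< (suc x ∸ lo) (λ i → columns (suc (lo + i)) (length α) (λ j → e + (a + prefixSum α j))))
            (ℕ.+-identityʳ e) ⟨
  columns lo (length (a ∷ α)) (λ i → e + prefixSum (a ∷ α) i) ∎
  where
  f : ℕ → List Content
  f t = map ((t , pred a) ∷_) (contents (suc t) (e + a) α)

-- For `lo = e = 0` the first letter is forced to be 0, so here too one column is saved.
length-contents-0 : ∀ α →
  length (contents 0 0 α) ≡ columns 1 (length α ∸ 1) (λ i → prefixSum α (suc i))
length-contents-0 []      = refl
length-contents-0 (a ∷ α) = trans (length-contents 0 0 (a ∷ α)) (ℕ.+-identityʳ _)

∈-contents⁻ : ∀ lo e α {K} → All (1 ≤_) α → K ∈ contents lo e α → sizes K ≡ α × Fits lo e K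
∈-contents⁻ lo e []          []            (here refl) = refl , tt
∈-contents⁻ lo e (suc b ∷ α) (_ ∷ α≥1) K∈
  with t , t∈ , K∈t ← find (∈-concatMap⁻ _ {xs = applyUpTo (_+_ lo) (suc e ∸ lo)} K∈)
  with i , i< , refl ← ∈-applyUpTo⁻ (_+_ lo) t∈
  with K′ , K′∈ , refl ← ∈-map⁻ ((lo + i , b) ∷_) K∈t
  with refl , fits ← ∈-contents⁻ (suc (lo + i)) (e + suc b) α α≥1 K′∈ =
  refl , ℕ.m≤m+n lo i , ℕ.≤-pred (subst (_≤ suc e) (ℕ.+-suc lo i) lo+i<) , fits
  where
  lo+i< : lo + suc i ≤ suc e
  lo+i< = subst (_≤ suc e) (ℕ.+-comm (suc i) lo)
    (ℕ.m≤o∸n⇒m+n≤o (suc i) (ℕ.<⇒≤ (ℕ.m∸n≢0⇒n<m (ℕ.m<n⇒n≢0 i<))) i<)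

∈-contents⁺ : ∀ lo e K → Fits lo e K → K ∈ contents lo e (sizes K)
∈-contents⁺ lo e []            _                    = here refl
∈-contents⁺ lo e ((t , b) ∷ K) (lo≤t , t≤e , fits) = ∈-concat⁺′
  (∈-map⁺ ((t , b) ∷_) (∈-contents⁺ (suc t) (e + suc b) K fits))
  (∈-map⁺ (λ t → map ((t , b) ∷_) (contents (suc t) (e + suc b) (sizes K)))
    (subst (_∈ applyUpTo (_+_ lo) (suc e ∸ lo)) (ℕ.m+[n∸m]≡n lo≤t)
      (∈-applyUpTo⁺ (_+_ lo) (ℕ.∸-monoˡ-< (s≤s t≤e) lo≤t))))

contents-unique : ∀ lo e α → Unique (contents lo e α)
contents-unique lo e []      = [] ∷ []
contents-unique lo e (a ∷ α) = unique-concatMap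
  (λ {t} _ → Unique.map⁺ ∷-injectiveʳ (contents-unique (suc t) (e + a) α))
  (λ _ _ → disjoint)
  (Unique.applyUpTo⁺₁ (_+_ lo) (suc e ∸ lo) λ i<j _ eq → ℕ.<⇒≢ i<j (ℕ.+-cancelˡ-≡ lo _ _ eq))
  where
  disjoint : ∀ {t u} → t ≢ u → Disjoint (map ((t , pred a) ∷_) (contents (suc t) (e + a) α))
                                        (map ((u , pred a) ∷_) (contents (suc u) (e + a) α))
  disjoint {t} {u} t≢u (K∈t , K∈u)
    with _ , _ , refl ← ∈-map⁻ ((t , pred a) ∷_) K∈t
    with _ , _ , eq ← ∈-map⁻ ((u , pred a) ∷_) K∈u = t≢u (cong proj₁ (∷-injectiveˡ eq))

fits⇒≤ : ∀ {lo e} K → Fits lo e K → All (λ u → lo ≤ proj₁ u) K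
fits⇒≤ []            _                   = []
fits⇒≤ ((t , b) ∷ K) (lo≤t , _ , fits) =
  lo≤t ∷ All.map (λ t<u → ℕ.≤-trans lo≤t (ℕ.<⇒≤ t<u)) (fits⇒≤ K fits)

fits⇒increasing : ∀ {lo e} K → Fits lo e K → Increasing _<_ K
fits⇒increasing []            _              = []
fits⇒increasing ((t , b) ∷ K) (_ , _ , fits) = fits⇒≤ K fits ∷ fits⇒increasing K fits

length-expand : ∀ K → length (expand K) ≡ sum (sizes K)
length-expand []            = refl
length-expand ((t , b) ∷ K) = cong suc (trans (length-++ (replicate b t))
  (cong₂ _+_ (length-replicate b) (length-expand K)))

parkingContents : ℕ → List Content
parkingContents n = concatMap (contents 0 0) (compositions n)

∈-parkingContents⁻ : ∀ n {K} → K ∈ parkingContents n → Fits 0 0 K × length (expand K) ≡ n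
∈-parkingContents⁻ n {K} K∈
  with α , α∈ , K∈α ← find (∈-concatMap⁻ (contents 0 0) {xs = compositions n} K∈)
  with α≥1 , refl ← ∈-compositions⁻ n α∈
  with refl , fits ← ∈-contents⁻ 0 0 α α≥1 K∈α = fits , length-expand K

∈-parkingContents⁺ : ∀ K → Fits 0 0 K → K ∈ parkingContents (length (expand K))
∈-parkingContents⁺ K fits = ∈-concat⁺′ (∈-contents⁺ 0 0 K fits)
  (∈-map⁺ (contents 0 0) (∈-compositions⁺ (length (expand K))
    (All.map⁺ (All.universal (λ _ → s≤s z≤n) K)) (sym (length-expand K))))

parkingContents-unique : ∀ n → Unique (parkingContents n)
parkingContents-unique n = unique-concatMap
  (λ {α} _ → contents-unique 0 0 α)
  (λ {α} {β} α∈ β∈ α≢β (K∈α , K∈β) →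
    α≢β (trans (sym (proj₁ (∈-contents⁻ 0 0 α (proj₁ (∈-compositions⁻ n α∈)) K∈α)))
               (proj₁ (∈-contents⁻ 0 0 β (proj₁ (∈-compositions⁻ n β∈)) K∈β))))
  (compositions-unique n)

length-concatMap-const : ∀ {B : Set} (f : A → List B) (xs : List A) c →
  (∀ {x} → x ∈ xs → + length (f x) ≡ c) → + length (concatMap f xs) ≡ + length xs ℤ.* c
length-concatMap-const f []       c len = refl
length-concatMap-const f (x ∷ xs) c len = begin
  + length (f x ++ concatMap f xs)
    ≡⟨ cong +_ (length-++ (f x)) ⟩
  + (length (f x) + length (concatMap f xs))
    ≡⟨ ℤ.pos-+ (length (f x)) (length (concatMap f xs)) ⟩
  + length (f x) ℤ.+ + length (concatMap f xs)
    ≡⟨ cong₂ ℤ._+_ (len (here refl)) (length-concatMap-const f xs c (len ∘ there)) ⟩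
  c ℤ.+ + length xs ℤ.* c
    ≡⟨ ℤ.suc-* (+ length xs) c ⟨
  + length (x ∷ xs) ℤ.* c ∎

-- Contents are grouped by composition: `α` has `det (matrixA α)` of them, and each contributes the
-- same `d α`.
length-concatMap-parkingContents : ∀ n (E : Content → List (List ℕ)) (d : List ℕ → ℤ) →
  (∀ {K} → K ∈ parkingContents n → + length (E K) ≡ d (sizes K)) →
  + length (concatMap E (parkingContents n)) ≡ ∑[ α ⊨ n ] (det (matrixA α) ℤ.* d α)
length-concatMap-parkingContents n E d E≡d = go (compositions n) (λ α∈ → α∈)
  where
  go : ∀ αs → (∀ {α} → α ∈ αs → α ∈ compositions n) →
       + length (concatMap E (concatMap (contents 0 0) αs)) ≡
       foldr (λ α s → det (matrixA α) ℤ.* d α ℤ.+ s) 0ℤ αs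
  go []       _  = refl
  go (α ∷ αs) αs⊆ = begin
    + length (concatMap E (contents 0 0 α ++ concatMap (contents 0 0) αs))
      ≡⟨ cong (λ L → + length L) (concatMap-++ E (contents 0 0 α) (concatMap (contents 0 0) αs)) ⟩
    + length (concatMap E (contents 0 0 α) ++ concatMap E (concatMap (contents 0 0) αs))
      ≡⟨ cong +_ (length-++ (concatMap E (contents 0 0 α))) ⟩
    + (length (concatMap E (contents 0 0 α)) + length (concatMap E (concatMap (contents 0 0) αs)))
      ≡⟨ ℤ.pos-+ (length (concatMap E (contents 0 0 α))) _ ⟩
    + length (concatMap E (contents 0 0 α)) ℤ.+ + length (concatMap E (concatMap (contents 0 0) αs))
      ≡⟨ cong₂ ℤ._+_ first (go αs (αs⊆ ∘ there)) ⟩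
    det (matrixA α) ℤ.* d α ℤ.+ foldr (λ α s → det (matrixA α) ℤ.* d α ℤ.+ s) 0ℤ αs ∎
    where
    α∈ = αs⊆ (here refl)
    first : + length (concatMap E (contents 0 0 α)) ≡ det (matrixA α) ℤ.* d α
    first = trans
      (length-concatMap-const E (contents 0 0 α) (d α) λ K∈ →
        trans (E≡d (∈-concat⁺′ K∈ (∈-map⁺ (contents 0 0) α∈)))
              (cong d (proj₁ (∈-contents⁻ 0 0 α (proj₁ (∈-compositions⁻ n α∈)) K∈))))
      (cong (ℤ._* d α) (sym (trans (det-matrixA α) (cong +_ (sym (length-contents-0 α))))))

-- Patterns in π(p)

allPairs-lookup : {R : Rel A ℓ} {xs : List A} → AllPairs R xs →
                  ∀ {i j} → i Fin.< j → R (lookup xs i) (lookup xs j)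
allPairs-lookup (Rx ∷ Rxs) {zero}  {suc j} i<j       = All.lookup Rx (∈-lookup j)
allPairs-lookup (Rx ∷ Rxs) {suc i} {suc j} (s≤s i<j) = allPairs-lookup Rxs i<j

allPairs-tabulate⁻ : ∀ {n} {R : Rel A ℓ} {f : Fin n → A} → AllPairs R (tabulate f) →
                     ∀ {i j} → i Fin.< j → R (f i) (f j)
allPairs-tabulate⁻ (Rx ∷ Rxs) {zero}  {suc j} i<j       = All.tabulate⁻ Rx j
allPairs-tabulate⁻ (Rx ∷ Rxs) {suc i} {suc j} (s≤s i<j) = allPairs-tabulate⁻ Rxs i<j

allPairs-reverse : {R : Rel A ℓ} (xs : List A) → AllPairs R xs → AllPairs (flip R) (reverse xs)
allPairs-reverse []       []         = []
allPairs-reverse (x ∷ xs) (Rx ∷ Rxs) rewrite unfold-reverse x xs =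
  AllPairs.++⁺ (allPairs-reverse xs Rxs) ([] ∷ [])
    (All.map (λ r → r ∷ []) (All-resp-↭ (↭-sym (↭-reverse xs)) Rx))

triples-tabulate⁺ : ∀ {A : Set} {n} {T : A → A → A → Set} {f : Fin n → A} →
  (∀ {i j k} → i Fin.< j → j Fin.< k → T (f i) (f j) (f k)) → Triples T (tabulate f)
triples-tabulate⁺ {n = zero}  t = tt
triples-tabulate⁺ {n = suc n} t =
  AllPairs.tabulate⁺-< (λ j<k → t (s≤s z≤n) (s≤s j<k)) ,
  triples-tabulate⁺ (λ i<j j<k → t (s≤s i<j) (s≤s j<k))

triples-tabulate⁻ : ∀ {A : Set} {n} {T : A → A → A → Set} {f : Fin n → A} → Triples T (tabulate f) →
  ∀ {i j k} → i Fin.< j → j Fin.< k → T (f i) (f j) (f k)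
triples-tabulate⁻ (Tx , t) {zero}  {suc j} {suc k} i<j       (s≤s j<k) = allPairs-tabulate⁻ Tx j<k
triples-tabulate⁻ (Tx , t) {suc i} {suc j} {suc k} (s≤s i<j) (s≤s j<k) = triples-tabulate⁻ t i<j j<k

triples-∷ʳ : ∀ {A : Set} {T : A → A → A → Set} w {z} →
             Triples T w → AllPairs (λ x y → T x y z) w → Triples T (w ∷ʳ z)
triples-∷ʳ []      t         p        = [] , tt
triples-∷ʳ (x ∷ w) (Tx , t) (px ∷ p) =
  AllPairs.++⁺ Tx ([] ∷ []) (All.map (λ r → r ∷ []) px) , triples-∷ʳ w t p

triples-reverse⁺ : ∀ {A : Set} {T : A → A → A → Set} w →
                   Triples (λ z y x → T x y z) w → Triples T (reverse w)
triples-reverse⁺ []      t = tt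
triples-reverse⁺ (z ∷ w) (Tz , t) rewrite unfold-reverse z w =
  triples-∷ʳ (reverse w) (triples-reverse⁺ w t) (allPairs-reverse w Tz)

triples-reverse⁻ : ∀ {A : Set} {T : A → A → A → Set} w →
                   Triples T (reverse w) → Triples (λ z y x → T x y z) w
triples-reverse⁻ {T = T} w t =
  subst (Triples _) (reverse-involutive w) (triples-reverse⁺ (reverse w) t)

module _ {n} (p : Vec (Fin n) n) where

  -- The order in which π(p) lists the indices.
  Precedes : Fin n → Fin n → Set
  Precedes i j = Vec.lookup p i Fin.< Vec.lookup p j ⊎ (Vec.lookup p i ≡ Vec.lookup p j × i Fin.< j)

  precedes-irrefl : ∀ {i} → ¬ Precedes i i
  precedes-irrefl (inj₁ pi<pi)     = ℕ.<-irrefl refl pi<pi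
  precedes-irrefl (inj₂ (_ , i<i)) = ℕ.<-irrefl refl i<i

  precedes-asym : ∀ {i j} → Precedes i j → ¬ Precedes j i
  precedes-asym (inj₁ pi<pj)         (inj₁ pj<pi)         = ℕ.<-asym pi<pj pj<pi
  precedes-asym (inj₁ pi<pj)         (inj₂ (pj≡pi , _))   = Fin.<-irrefl (sym pj≡pi) pi<pj
  precedes-asym (inj₂ (pi≡pj , _))   (inj₁ pj<pi)         = Fin.<-irrefl (sym pi≡pj) pj<pi
  precedes-asym (inj₂ (_ , i<j))     (inj₂ (_ , j<i))     = ℕ.<-asym i<j j<i

  precedes⇒≤ : ∀ {i j} → Precedes i j → Vec.lookup p i Fin.≤ Vec.lookup p j
  precedes⇒≤ (inj₁ pi<pj)       = ℕ.<⇒≤ pi<pj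
  precedes⇒≤ (inj₂ (pi≡pj , _)) = ℕ.≤-reflexive (cong toℕ pi≡pj)

  precedes⇒< : ∀ {i j} → j Fin.< i → Precedes i j → Vec.lookup p i Fin.< Vec.lookup p j
  precedes⇒< j<i (inj₁ pi<pj)     = pi<pj
  precedes⇒< j<i (inj₂ (_ , i<j)) = ⊥-elim (ℕ.<-asym i<j j<i)

  ≤⇒precedes : ∀ {i j} → i Fin.< j → Vec.lookup p i Fin.≤ Vec.lookup p j → Precedes i j
  ≤⇒precedes {i} {j} i<j pi≤pj with Vec.lookup p i Fin.<? Vec.lookup p j
  ... | yes pi<pj = inj₁ pi<pj
  ... | no  pi≮pj = inj₂ (Fin.≤-antisym pi≤pj (ℕ.≮⇒≥ pi≮pj) , i<j)

  private
    block : Fin n → List (Fin n)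
    block s = filter (λ j → Vec.lookup p j Fin.≟ s) (allFin n)

    block-value : ∀ {s j} → j ∈ block s → Vec.lookup p j ≡ s
    block-value {s} j∈ = proj₂ (∈-filter⁻ (λ j → Vec.lookup p j Fin.≟ s) {xs = allFin n} j∈)

  -- Inside a block the values agree and the indices increase; from block to block the values
  -- increase.
  π-sorted : AllPairs Precedes (π p)
  π-sorted = AllPairs.concat⁺
    (All.map⁺ (All.universal (λ s → in-block s (block s) (λ j∈ → j∈)
       (AllPairs.filter⁺ (λ j → Vec.lookup p j Fin.≟ s) (AllPairs.tabulate⁺-< (λ i<j → i<j)))) (allFin n)))
    (AllPairs.map⁺ (AllPairs.map across (AllPairs.tabulate⁺-< (λ i<j → i<j))))
    where
    in-block : ∀ s xs → (∀ {j} → j ∈ xs → j ∈ block s) → AllPairs Fin._<_ xs → AllPairs Precedes xs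
    in-block s []       xs⊆ []         = []
    in-block s (x ∷ xs) xs⊆ (x< ∷ xs<) =
      All.tabulate (λ j∈ → inj₂ (trans (block-value (xs⊆ (here refl)))
                                       (sym (block-value (xs⊆ (there j∈)))) , All.lookup x< j∈))
      ∷ in-block s xs (xs⊆ ∘ there) xs<
    across : ∀ {s t} → s Fin.< t → All (λ i → All (Precedes i) (block t)) (block s)
    across s<t = All.tabulate λ i∈ → All.tabulate λ j∈ →
      inj₁ (subst₂ Fin._<_ (sym (block-value i∈)) (sym (block-value j∈)) s<t)

  ∈-π : ∀ j → j ∈ π p
  ∈-π j = ∈-concat⁺′ (∈-filter⁺ (λ j′ → Vec.lookup p j′ Fin.≟ Vec.lookup p j) (∈-allFin j) refl)
                     (∈-map⁺ block (∈-allFin (Vec.lookup p j)))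

  precedes⇒position-< : ∀ {a b} → Precedes (lookup (π p) a) (lookup (π p) b) → a Fin.< b
  precedes⇒position-< {a} {b} prec with Fin.<-cmp a b
  ... | tri< a<b _ _  = a<b
  ... | tri≈ _ refl _ = ⊥-elim (precedes-irrefl prec)
  ... | tri> _ _ b<a  = ⊥-elim (precedes-asym prec (allPairs-lookup π-sorted b<a))

  -- Together with `contains⁺` this turns a pattern into a chain of indices under `Precedes`, so
  -- that positions in π(p) no longer occur.
  contains⁻ : ∀ σ → Contains (π p) σ →
    ∃[ x ] ∃[ y ] ∃[ z ] Precedes x y × Precedes y z × OrderIsomorphic (x ∷ y ∷ z ∷ []) σ
  contains⁻ σ (a , b , c , a<b , b<c , iso) =
    lookup (π p) a , lookup (π p) b , lookup (π p) c ,
    allPairs-lookup π-sorted a<b , allPairs-lookup π-sorted b<c , iso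

  contains⁺ : ∀ σ {x y z} → Precedes x y → Precedes y z → OrderIsomorphic (x ∷ y ∷ z ∷ []) σ →
              Contains (π p) σ
  contains⁺ σ {x} {y} {z} xy yz iso =
    index x , index y , index z ,
    precedes⇒position-< (subst₂ Precedes (lookup-index′ x) (lookup-index′ y) xy) ,
    precedes⇒position-< (subst₂ Precedes (lookup-index′ y) (lookup-index′ z) yz) ,
    subst (λ v → OrderIsomorphic v σ)
          (cong₂ _∷_ (lookup-index′ x) (cong₂ (λ y z → y ∷ z ∷ []) (lookup-index′ y) (lookup-index′ z)))
          iso
    where
    index : Fin n → Fin (length (π p))
    index j = Any.index (∈-π j)
    lookup-index′ : ∀ j → j ≡ lookup (π p) (index j)
    lookup-index′ j = lookup-index (∈-π j)

-- By trichotomy, the implication from `v` to `u` gives its converse once `v` has distinct entries.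
orderIsomorphic : ∀ {m n k} (u : Vec (Fin m) k) (v : Vec (Fin n) k) →
  (∀ {a b} → Vec.lookup v a ≡ Vec.lookup v b → a ≡ b) →
  (∀ a b → Vec.lookup v a Fin.< Vec.lookup v b → Vec.lookup u a Fin.< Vec.lookup u b) →
  OrderIsomorphic u v
orderIsomorphic u v inj v⇒u a b = mk⇔ u⇒v (v⇒u a b)
  where
  u⇒v : Vec.lookup u a Fin.< Vec.lookup u b → Vec.lookup v a Fin.< Vec.lookup v b
  u⇒v ua<ub with Fin.<-cmp (Vec.lookup v a) (Vec.lookup v b)
  ... | tri< va<vb _ _ = va<vb
  ... | tri≈ _ va≡vb _ = ⊥-elim (Fin.<-irrefl (cong (Vec.lookup u) (inj va≡vb)) ua<ub)
  ... | tri> _ _ vb<va = ⊥-elim (ℕ.<-asym ua<ub (v⇒u b a vb<va))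

-- Counting parking functions

word : ∀ {n k} → Vec (Fin n) k → List ℕ
word p = map toℕ (Vec.toList p)

word≡tabulate : ∀ {n k} (p : Vec (Fin n) k) → word p ≡ tabulate (λ i → toℕ (Vec.lookup p i))
word≡tabulate []      = refl
word≡tabulate (x ∷ p) = cong (toℕ x ∷_) (word≡tabulate p)

length-word : ∀ {n k} (p : Vec (Fin n) k) → length (word p) ≡ k
length-word p = trans (cong length (word≡tabulate p)) (length-tabulate _)

word-injective : ∀ {n k} {p q : Vec (Fin n) k} → word p ≡ word q → p ≡ q
word-injective {p = p} {q} eq =
  trans (sym (Vec.cast-is-id refl p))
        (Vec.toList-injective refl p q (map-injective Fin.toℕ-injective eq))

word-surjective : ∀ {n k} w → length w ≡ k → All (_< n) w → ∃[ p ] word {n} {k} p ≡ w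
word-surjective []      refl []          = [] , refl
word-surjective (x ∷ w) refl (x<n ∷ w<n) =
  let p , eq = word-surjective w refl w<n
  in fromℕ< x<n ∷ p , cong₂ _∷_ (Fin.toℕ-fromℕ< x<n) eq

∈-tuples : ∀ {m k} (p : Vec (Fin m) k) → p ∈ tuples m k
∈-tuples []      = here refl
∈-tuples (x ∷ p) = ∈-cartesianProductWith⁺ _∷_ (∈-allFin x) (∈-tuples p)

tuples-unique : ∀ m k → Unique (tuples m k)
tuples-unique m zero    = [] ∷ []
tuples-unique m (suc k) =
  Unique.cartesianProductWith⁺ _∷_ Vec.∷-injective (Unique.allFin⁺ m) (tuples-unique m k)

-- The values 0, 1, 2 of `σ` are replaced by `i`, `j`, `k` in the same order. Injectivity of a
-- concrete `σ` is settled by evaluation.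
increasing-orderIsomorphic : ∀ {n} {i j k : Fin n} (σ : Vec (Fin 3) 3) →
  {True (Fin.all? λ a → Fin.all? λ b →
    (Vec.lookup σ a Fin.≟ Vec.lookup σ b) →-dec (a Fin.≟ b))} →
  i Fin.< j → j Fin.< k →
  OrderIsomorphic (Vec.map (Vec.lookup (i ∷ j ∷ k ∷ [])) σ) σ
increasing-orderIsomorphic {i = i} {j} {k} σ {inj} i<j j<k =
  orderIsomorphic (Vec.map chain σ) σ (λ {a} {b} → toWitness inj a b) λ a b σa<σb →
    subst₂ Fin._<_ (sym (Vec.lookup-map a chain σ)) (sym (Vec.lookup-map b chain σ))
           (mono (Vec.lookup σ a) (Vec.lookup σ b) σa<σb)
  where
  chain : Fin 3 → Fin _
  chain = Vec.lookup (i ∷ j ∷ k ∷ [])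
  mono : ∀ a b → a Fin.< b → chain a Fin.< chain b
  mono 0F 1F _ = i<j
  mono 0F 2F _ = ℕ.<-trans i<j j<k
  mono 1F 2F _ = j<k
  mono 1F 1F (s≤s ())
  mono 2F 1F (s≤s ())
  mono 2F 2F (s≤s (s≤s ()))

module _ {n} (p : Vec (Fin n) n) where

  private
    triples⁺ : {T : ℕ → ℕ → ℕ → Set} →
      (∀ {i j k} → i Fin.< j → j Fin.< k →
        T (toℕ (Vec.lookup p i)) (toℕ (Vec.lookup p j)) (toℕ (Vec.lookup p k))) →
      Triples T (word p)
    triples⁺ t = subst (Triples _) (sym (word≡tabulate p)) (triples-tabulate⁺ t)

    triples⁻ : {T : ℕ → ℕ → ℕ → Set} → Triples T (word p) →
      ∀ {i j k} → i Fin.< j → j Fin.< k →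
      T (toℕ (Vec.lookup p i)) (toℕ (Vec.lookup p j)) (toℕ (Vec.lookup p k))
    triples⁻ t = triples-tabulate⁻ (subst (Triples _) (word≡tabulate p) t)

  -- In terms of indices i < j < k, the patterns 213, 312, 132 and 231 in π(p) amount to
  -- p_j < p_i ≤ p_k, p_k < p_i ≤ p_j, p_i ≤ p_k < p_j and p_j ≤ p_k < p_i.
  avoids-213 : Avoids (π p) σ213 ⇔ Avoiding _<_ high (word p)
  avoids-213 = mk⇔
    (λ avoids → triples⁺ λ i<j j<k pj<pi → ℕ.≰⇒> λ pi≤pk →
      avoids (contains⁺ p σ213 (inj₁ pj<pi) (≤⇒precedes p (ℕ.<-trans i<j j<k) pi≤pk)
                (increasing-orderIsomorphic σ213 i<j j<k)))
    (λ A contains →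
      let x , y , z , xy , yz , iso = contains⁻ p σ213 contains
          y<x = Equivalence.from (iso 1F 0F) (s≤s z≤n)
          x<z = Equivalence.from (iso 0F 2F) (s≤s (s≤s z≤n))
      in ℕ.<⇒≱ (triples⁻ A y<x x<z (precedes⇒< p y<x xy)) (precedes⇒≤ p yz))

  avoids-312 : Avoids (π p) σ312 ⇔ Avoiding _<_ low (word p)
  avoids-312 = mk⇔
    (λ avoids → triples⁺ λ i<j j<k pj≮pi pk<pi →
      avoids (contains⁺ p σ312 (inj₁ pk<pi) (≤⇒precedes p i<j (ℕ.≮⇒≥ pj≮pi))
                (increasing-orderIsomorphic σ312 i<j j<k)))
    (λ A contains →
      let x , y , z , xy , yz , iso = contains⁻ p σ312 contains
          y<z = Equivalence.from (iso 1F 2F) (s≤s z≤n)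
          z<x = Equivalence.from (iso 2F 0F) (s≤s (s≤s z≤n))
      in triples⁻ A y<z z<x (ℕ.≤⇒≯ (precedes⇒≤ p yz)) (precedes⇒< p (ℕ.<-trans y<z z<x) xy))

  -- Read backwards, `k` leads, and under `_>_` a letter is late when it exceeds p_k: so p_k < p_j
  -- must imply p_k < p_i.
  avoids-132 : Avoids (π p) σ132 ⇔ Avoiding _>_ high (reverse (word p))
  avoids-132 = mk⇔
    (λ avoids → triples-reverse⁺ (word p) (triples⁺ λ i<j j<k pk<pj → ℕ.≰⇒> λ pi≤pk →
      avoids (contains⁺ p σ132 (≤⇒precedes p (ℕ.<-trans i<j j<k) pi≤pk) (inj₁ pk<pj)
                (increasing-orderIsomorphic σ132 i<j j<k))))
    (λ A contains →
      let x , y , z , xy , yz , iso = contains⁻ p σ132 contains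
          x<z = Equivalence.from (iso 0F 2F) (s≤s z≤n)
          z<y = Equivalence.from (iso 2F 1F) (s≤s (s≤s z≤n))
      in ℕ.<⇒≱ (triples⁻ (triples-reverse⁻ (word p) A) x<z z<y (precedes⇒< p z<y yz)) (precedes⇒≤ p xy))

  avoids-231 : Avoids (π p) σ231 ⇔ Avoiding _>_ low (reverse (word p))
  avoids-231 = mk⇔
    (λ avoids → triples-reverse⁺ (word p) (triples⁺ λ i<j j<k pk≮pj pk<pi →
      avoids (contains⁺ p σ231 (≤⇒precedes p j<k (ℕ.≮⇒≥ pk≮pj)) (inj₁ pk<pi)
                (increasing-orderIsomorphic σ231 i<j j<k))))
    (λ A contains →
      let x , y , z , xy , yz , iso = contains⁻ p σ231 contains
          z<x = Equivalence.from (iso 2F 0F) (s≤s z≤n)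
          x<y = Equivalence.from (iso 0F 1F) (s≤s (s≤s z≤n))
      in triples⁻ (triples-reverse⁻ (word p) A) z<x x<y (ℕ.≤⇒≯ (precedes⇒≤ p xy))
                  (precedes⇒< p (ℕ.<-trans z<x x<y) yz))

-- Parking functions and their contents

pushRun : ℕ → Content → Content
pushRun x []            = (x , 0) ∷ []
pushRun x ((t , b) ∷ K) with x ℕ.≟ t
... | yes _ = (t , suc b) ∷ K
... | no  _ = (x , 0) ∷ (t , b) ∷ K

runs : List ℕ → Content
runs []       = []
runs (x ∷ xs) = pushRun x (runs xs)

expand-pushRun : ∀ x K → expand (pushRun x K) ≡ x ∷ expand K
expand-pushRun x []            = refl
expand-pushRun x ((t , b) ∷ K) with x ℕ.≟ t
... | yes refl = refl
... | no  _    = refl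

expand-runs : ∀ xs → expand (runs xs) ≡ xs
expand-runs []       = refl
expand-runs (x ∷ xs) = trans (expand-pushRun x (runs xs)) (cong (x ∷_) (expand-runs xs))

pushRun-same : ∀ t b K → pushRun t ((t , b) ∷ K) ≡ (t , suc b) ∷ K
pushRun-same t b K with t ℕ.≟ t
... | yes _  = refl
... | no t≢t = ⊥-elim (t≢t refl)

pushRun-below : ∀ {t} K → All (λ u → t < proj₁ u) K → pushRun t K ≡ (t , 0) ∷ K
pushRun-below             []            _         = refl
pushRun-below {t} ((u , b) ∷ K) (t<u ∷ _) with t ℕ.≟ u
... | yes refl = ⊥-elim (ℕ.<-irrefl refl t<u)
... | no _     = refl

runs-expand : ∀ K → Increasing _<_ K → runs (expand K) ≡ K
runs-expand []            []       = refl
runs-expand ((t , b) ∷ K) (t< ∷ I) = copies b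
  where
  copies : ∀ b → runs (t ∷ replicate b t ++ expand K) ≡ (t , b) ∷ K
  copies zero    = trans (cong (pushRun t) (runs-expand K I)) (pushRun-below K t<)
  copies (suc b) = trans (cong (pushRun t) (copies b)) (pushRun-same t b K)

-- The parking condition as a recursion along the sorted list, with `e` the bound for its first
-- entry.
ParkingFrom : ℕ → List ℕ → Set
ParkingFrom e []       = ⊤
ParkingFrom e (x ∷ xs) = x ≤ e × ParkingFrom (suc e) xs

parkingFrom⁺ : ∀ {n} e (xs : List (Fin n)) → (∀ i → toℕ (lookup xs i) ≤ e + toℕ i) →
               ParkingFrom e (map toℕ xs)
parkingFrom⁺ e []       f = tt
parkingFrom⁺ e (x ∷ xs) f =
  subst (toℕ x ≤_) (ℕ.+-identityʳ e) (f zero) ,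
  parkingFrom⁺ (suc e) xs λ i → subst (toℕ (lookup xs i) ≤_) (ℕ.+-suc e (toℕ i)) (f (suc i))

parkingFrom⁻ : ∀ {n} e (xs : List (Fin n)) → ParkingFrom e (map toℕ xs) →
               ∀ i → toℕ (lookup xs i) ≤ e + toℕ i
parkingFrom⁻ e (x ∷ xs) (x≤e , P) zero    = subst (toℕ x ≤_) (sym (ℕ.+-identityʳ e)) x≤e
parkingFrom⁻ e (x ∷ xs) (x≤e , P) (suc i) =
  subst (toℕ (lookup xs i) ≤_) (sym (ℕ.+-suc e (toℕ i))) (parkingFrom⁻ (suc e) xs P i)

fits-runs : ∀ {lo e} xs → AllPairs _≤_ xs → All (lo ≤_) xs → ParkingFrom e xs → Fits lo e (runs xs)
fits-runs          []       _            _          _         = tt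
fits-runs {lo} {e} (x ∷ xs) (x≤ ∷ ≤xs) (lo≤x ∷ _) (x≤e , P) =
  -- With `x` as lower bound for the tail, its first run either has letter `x` and absorbs the new
  -- copy, or has a strictly larger letter.
  push (runs xs) (fits-runs xs ≤xs x≤ P)
  where
  push : ∀ K → Fits x (suc e) K → Fits lo e (pushRun x K)
  push []            fits              = lo≤x , x≤e , tt
  push ((t , b) ∷ K) (x≤t , t≤e , fits) with x ℕ.≟ t
  ... | yes refl = lo≤x , x≤e , subst (λ e → Fits (suc x) e K) (sym (ℕ.+-suc e (suc b))) fits
  ... | no  x≢t  = lo≤x , x≤e , ℕ.≤∧≢⇒< x≤t x≢t ,
    subst (λ e → t ≤ e × Fits (suc t) (e + suc b) K) (sym (ℕ.+-comm e 1)) (t≤e , fits)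

-- Only the first copy of each letter matters, since the later copies meet larger bounds.
fits⇒parkingFrom : ∀ {lo e} K → Fits lo e K → ParkingFrom e (expand K)
fits⇒parkingFrom         []            _                = tt
fits⇒parkingFrom {e = e} ((t , b) ∷ K) (_ , t≤e , fits) = t≤e , copies b (suc e) (ℕ.m≤n⇒m≤1+n t≤e)
  (subst (λ e → ParkingFrom e (expand K)) (ℕ.+-suc e b) (fits⇒parkingFrom K fits))
  where
  copies : ∀ b e → t ≤ e → ParkingFrom (e + b) (expand K) → ParkingFrom e (replicate b t ++ expand K)
  copies zero    e t≤e P = subst (λ e → ParkingFrom e (expand K)) (ℕ.+-identityʳ e) P
  copies (suc b) e t≤e P = t≤e , copies b (suc e) (ℕ.m≤n⇒m≤1+n t≤e)
    (subst (λ e → ParkingFrom e (expand K)) (ℕ.+-suc e b) P)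

increasing⇒sorted : ∀ K → Increasing _<_ K → AllPairs _≤_ (expand K)
increasing⇒sorted []            []       = []
increasing⇒sorted ((t , b) ∷ K) (t< ∷ I) = copies (suc b)
  where
  t≤K : All (t ≤_) (expand K)
  t≤K = all-expand (All.map ℕ.<⇒≤ t<)
  copies : ∀ b → AllPairs _≤_ (replicate b t ++ expand K)
  copies zero    = increasing⇒sorted K I
  copies (suc b) = All.++⁺ (All.replicate⁺ b ℕ.≤-refl) t≤K ∷ copies b

sorted-↭⇒≡ : ∀ {xs ys} → AllPairs _≤_ xs → AllPairs _≤_ ys → xs ↭ ys → xs ≡ ys
sorted-↭⇒≡ ≤xs ≤ys xs↭ys = Pointwise-≡⇒≡
  (↗↭↗⇒≋ ℕ.≤-totalOrder (AllPairs⇒Sorted ℕ.≤-totalOrder ≤xs) (AllPairs⇒Sorted ℕ.≤-totalOrder ≤ys)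
         (↭⇒↭ₛ xs↭ys))

module _ {n} (p : Vec (Fin n) n) where

  private
    open SortingAlgorithm (InsertionSort.insertionSort (Fin.≤-decTotalOrder n))
      using (sort-↭; sort-↗)

    sorted : List ℕ
    sorted = map toℕ (rearrangement p)

    sorted-↭ : sorted ↭ word p
    sorted-↭ = ↭-map⁺ toℕ (sort-↭ (Vec.toList p))

    sorted-≤ : AllPairs _≤_ sorted
    sorted-≤ = AllPairs.map⁺ (Sorted⇒AllPairs (Fin.≤-totalOrder n) (sort-↗ (Vec.toList p)))

  isParking⇒content : IsParking p → ∃[ K ] Fits 0 0 K × word p ↭ expand K
  isParking⇒content parking =
    runs sorted ,
    fits-runs sorted sorted-≤ (All.universal (λ _ → z≤n) sorted)
              (parkingFrom⁺ 0 (rearrangement p) parking) ,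
    ↭-trans (↭-sym sorted-↭) (↭-reflexive (sym (expand-runs sorted)))

  -- Sorted rearrangements are unique, so this one is `expand K`, whose bounds are known.
  content⇒isParking : ∀ K → Fits 0 0 K → word p ↭ expand K → IsParking p
  content⇒isParking K fits p↭ = parkingFrom⁻ 0 (rearrangement p)
    (subst (ParkingFrom 0)
      (sym (sorted-↭⇒≡ sorted-≤ (increasing⇒sorted K (fits⇒increasing K fits)) (↭-trans sorted-↭ p↭)))
      (fits⇒parkingFrom K fits))

-- Counting tuples by a bijection with enumerated words

parkingFrom⇒< : ∀ {e} xs → ParkingFrom e xs → All (_< e + length xs) xs
parkingFrom⇒<         []       _         = []
parkingFrom⇒< {e} (x ∷ xs) (x≤e , P) rewrite ℕ.+-suc e (length xs) =
  s≤s (ℕ.≤-trans x≤e (ℕ.m≤m+n e (length xs))) ∷ parkingFrom⇒< xs P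

length-filter-bijection : ∀ {p} {P : Pred A p} (P? : Decidable P) (f : A → B) {xs ys} →
  (∀ {x y} → f x ≡ f y → x ≡ y) → Unique xs → Unique ys →
  (∀ {x} → x ∈ xs → P x → f x ∈ ys) →
  (∀ {y} → y ∈ ys → ∃[ x ] x ∈ xs × P x × f x ≡ y) →
  length (filter P? xs) ≡ length ys
length-filter-bijection P? f {xs} {ys} inj xs! ys! to from =
  trans (sym (length-map f (filter P? xs)))
    (↭-length (∼bag⇒↭ (unique∧set⇒bag (Unique.map⁺ inj (Unique.filter⁺ P? xs!)) ys! (mk⇔ to′ from′))))
  where
  to′ : ∀ {y} → y ∈ map f (filter P? xs) → y ∈ ys
  to′ y∈ with x , x∈ , refl ← ∈-map⁻ f y∈ =
    let x∈xs , px = ∈-filter⁻ P? {xs = xs} x∈ in to x∈xs px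
  from′ : ∀ {y} → y ∈ ys → y ∈ map f (filter P? xs)
  from′ y∈ with x , x∈ , px , refl ← from y∈ = ∈-map⁺ f (∈-filter⁺ P? x∈ px)

-- What the count needs to know about a pattern: avoidance as a property of the word, and a
-- duplicate-free list of the words with that property for each content.
record Enumeration (n : ℕ) (σ : Vec (Fin 3) 3) : Set₁ where
  field
    Good     : List ℕ → Set
    avoids   : ∀ p → Avoids (π {n} p) σ ⇔ Good (word p)
    elements : Content → List (List ℕ)
    sound    : ∀ {K w} → K ∈ parkingContents n → w ∈ elements K → w ↭ expand K × Good w
    complete : ∀ {K w} → K ∈ parkingContents n → w ↭ expand K → Good w → w ∈ elements K
    unique   : ∀ {K} → K ∈ parkingContents n → Unique (elements K)

module _ {n σ} (E : Enumeration n σ) where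
  open Enumeration E

  private
    content-unique : ∀ {K L} → K ∈ parkingContents n → L ∈ parkingContents n →
                     expand K ↭ expand L → K ≡ L
    content-unique {K} {L} K∈ L∈ K↭L = trans (sym (runs-expand K IK)) (trans
      (cong runs (sorted-↭⇒≡ (increasing⇒sorted K IK) (increasing⇒sorted L IL) K↭L)) (runs-expand L IL))
      where
      IK = fits⇒increasing K (proj₁ (∈-parkingContents⁻ n K∈))
      IL = fits⇒increasing L (proj₁ (∈-parkingContents⁻ n L∈))

    tuple⇒element : ∀ {p : Vec (Fin n) n} → IsParking p → Avoids (π p) σ →
                    word p ∈ concatMap elements (parkingContents n)
    tuple⇒element {p} parking avoiding =
      ∈-concat⁺′ (complete K∈ p↭K (Equivalence.to (avoids p) avoiding)) (∈-map⁺ elements K∈)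
      where
      content = isParking⇒content p parking
      K    = proj₁ content
      fits = proj₁ (proj₂ content)
      p↭K  = proj₂ (proj₂ content)
      K∈ : K ∈ parkingContents n
      K∈ = subst (λ m → K ∈ parkingContents m) (trans (sym (↭-length p↭K)) (length-word p))
                 (∈-parkingContents⁺ K fits)

    element⇒tuple : ∀ {K w} → K ∈ parkingContents n → w ∈ elements K →
                    ∃[ p ] p ∈ tuples n n × (IsParking p × Avoids (π p) σ) × word p ≡ w
    element⇒tuple {K} {w} K∈ w∈ =
      p , ∈-tuples p ,
      (content⇒isParking p K fits (subst (_↭ expand K) (sym eq) w↭K) ,
       Equivalence.from (avoids p) (subst Good (sym eq) good)) , eq
      where
      w↭K  = proj₁ (sound K∈ w∈)
      good = proj₂ (sound K∈ w∈)
      fits = proj₁ (∈-parkingContents⁻ n K∈)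
      size = proj₂ (∈-parkingContents⁻ n K∈)
      -- The parking bounds keep the letters below the length `n`, so that `w` is the word of a
      -- tuple over `Fin n`.
      letters<n : All (_< n) w
      letters<n = All-resp-↭ (↭-sym w↭K)
        (subst (λ m → All (_< m) (expand K)) size
               (parkingFrom⇒< (expand K) (fits⇒parkingFrom K fits)))
      preimage : ∃[ p ] word {n} {n} p ≡ w
      preimage = word-surjective w (trans (↭-length w↭K) size) letters<n
      p  = proj₁ preimage
      eq = proj₂ preimage

  pf≡length : pf n σ ≡ length (concatMap elements (parkingContents n))
  pf≡length = length-filter-bijection (λ p → isParking? p ×-dec ¬? (contains? (π p) σ)) word
    word-injective (tuples-unique n n)
    (unique-concatMap unique
      (λ K∈ L∈ K≢L (w∈K , w∈L) → K≢L (content-unique K∈ L∈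
        (↭-trans (↭-sym (proj₁ (sound K∈ w∈K))) (proj₁ (sound L∈ w∈L)))))
      (parkingContents-unique n))
    (λ _ (parking , avoiding) → tuple⇒element parking avoiding)
    (λ w∈ → let _ , K∈ , w∈K = find (∈-concatMap⁻ elements {xs = parkingContents n} w∈)
            in element⇒tuple K∈ w∈K)

expand-reverse : ∀ K → expand (reverse K) ↭ expand K
expand-reverse []            = ↭-refl
expand-reverse ((t , b) ∷ K)
  rewrite unfold-reverse (t , b) K | expand-++ (reverse K) ((t , b) ∷ []) | ++-identityʳ (replicate b t) =
  ↭-trans (++-comm (expand (reverse K)) (t ∷ replicate b t)) (++⁺ ↭-refl (expand-reverse K))

parkingContents-increasing : ∀ n {K} → K ∈ parkingContents n → Increasing _<_ K
parkingContents-increasing n {K} K∈ = fits⇒increasing K (proj₁ (∈-parkingContents⁻ n K∈))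

parkingContents-decreasing : ∀ n {K} → K ∈ parkingContents n → Increasing _>_ (reverse K)
parkingContents-decreasing n {K} K∈ = allPairs-reverse K (parkingContents-increasing n K∈)

length-expand-reverse : ∀ n {K} → K ∈ parkingContents n → length (expand (reverse K)) ≡ n
length-expand-reverse n {K} K∈ =
  trans (↭-length (expand-reverse K)) (proj₂ (∈-parkingContents⁻ n K∈))

>-isStrictTotalOrder : IsStrictTotalOrder _≡_ _>_
>-isStrictTotalOrder = Flip.isStrictTotalOrder ℕ.<-isStrictTotalOrder

forward : ∀ {n} σ s → (∀ p → Avoids (π {n} p) σ ⇔ Avoiding _<_ s (word p)) → Enumeration n σ
forward {n} σ s avoids = record
  { Good     = Avoiding _<_ s
  ; avoids   = avoids
  ; elements = words s n
  ; sound    = λ {K} K∈ → words-sound _<_ ℕ.<-isStrictTotalOrder s n K (parkingContents-increasing n K∈)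
  ; complete = λ {K} K∈ w↭ → words-complete _<_ ℕ.<-isStrictTotalOrder s n K
      (parkingContents-increasing n K∈)
      (ℕ.≤-reflexive (trans (↭-length w↭) (proj₂ (∈-parkingContents⁻ n K∈)))) w↭
  ; unique   = λ {K} K∈ →
      words-unique _<_ ℕ.<-isStrictTotalOrder s n K (parkingContents-increasing n K∈)
  }

-- Under `_>_` the reversed content is increasing, so the same enumeration applies to it; its words
-- are then reversed back.
backward : ∀ {n} σ s → (∀ p → Avoids (π {n} p) σ ⇔ Avoiding _>_ s (reverse (word p))) →
           Enumeration n σ
backward {n} σ s avoids = record
  { Good     = λ w → Avoiding _>_ s (reverse w)
  ; avoids   = avoids
  ; elements = λ K → map reverse (words s n (reverse K))
  ; sound    = sound
  ; complete = complete
  ; unique   = λ {K} K∈ → Unique.map⁺ reverse-injective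
      (words-unique _>_ >-isStrictTotalOrder s n (reverse K) (parkingContents-decreasing n K∈))
  }
  where
  sound : ∀ {K w} → K ∈ parkingContents n → w ∈ map reverse (words s n (reverse K)) →
          w ↭ expand K × Avoiding _>_ s (reverse w)
  sound {K} K∈ w∈
    with v , v∈ , refl ← ∈-map⁻ reverse w∈
    with v↭ , A ← words-sound _>_ >-isStrictTotalOrder s n (reverse K) (parkingContents-decreasing n K∈) v∈ =
    ↭-trans (↭-reverse v) (↭-trans v↭ (expand-reverse K)) ,
    subst (Avoiding _>_ s) (sym (reverse-involutive v)) A
  complete : ∀ {K w} → K ∈ parkingContents n → w ↭ expand K → Avoiding _>_ s (reverse w) →
             w ∈ map reverse (words s n (reverse K))
  complete {K} {w} K∈ w↭ A = subst (_∈ map reverse (words s n (reverse K))) (reverse-involutive w)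
    (∈-map⁺ reverse (words-complete _>_ >-isStrictTotalOrder s n (reverse K)
      (parkingContents-decreasing n K∈)
      (ℕ.≤-reflexive (trans (↭-length reverse-w↭) (length-expand-reverse n K∈))) reverse-w↭ A))
    where
    reverse-w↭ : reverse w ↭ expand (reverse K)
    reverse-w↭ = ↭-trans (↭-reverse w) (↭-trans w↭ (↭-sym (expand-reverse K)))

det-matrixC : ∀ K → + insertions 0 K ≡ det (matrixC (sizes K))
det-matrixC K = trans
  (cong +_ (trans (insertions-0 K)
    (cong (λ m → columns 1 (m ∸ 1) (λ i → prefixSum (sizes K) (suc i) + suc i))
          (sym (length-map (suc ∘ proj₂) K)))))
  (sym (det-shifted (length (sizes K) ∸ 1) (sizes K)))

-- Reversing the content reverses `α`, which turns prefix sums into suffix sums.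
det-matrixB : ∀ K → + insertions 0 (reverse K) ≡ det (matrixB (sizes K))
det-matrixB K = trans
  (cong +_ (trans (insertions-0 (reverse K))
    (cong₂ (λ m α → columns 1 (m ∸ 1) (λ i → prefixSum α (suc i) + suc i))
           (trans (length-reverse K) (sym (length-map (suc ∘ proj₂) K)))
           (reverse-map (suc ∘ proj₂) K))))
  (sym (det-shifted (length (sizes K) ∸ 1) (reverse (sizes K))))

pf-forward : ∀ {n} σ s → (∀ p → Avoids (π {n} p) σ ⇔ Avoiding _<_ s (word p)) →
             + pf n σ ≡ ∑[ α ⊨ n ] (det (matrixA α) ℤ.* det (matrixC α))
pf-forward {n} σ s avoids = trans (cong +_ (pf≡length {n} {σ} (forward σ s avoids)))
  (length-concatMap-parkingContents n (words s n) (λ α → det (matrixC α)) λ {K} K∈ →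
    trans (cong +_ (length-words s n K (ℕ.≤-reflexive (proj₂ (∈-parkingContents⁻ n K∈)))))
          (det-matrixC K))

pf-backward : ∀ {n} σ s → (∀ p → Avoids (π {n} p) σ ⇔ Avoiding _>_ s (reverse (word p))) →
              + pf n σ ≡ ∑[ α ⊨ n ] (det (matrixA α) ℤ.* det (matrixB α))
pf-backward {n} σ s avoids = trans (cong +_ (pf≡length {n} {σ} (backward σ s avoids)))
  (length-concatMap-parkingContents n (λ K → map reverse (words s n (reverse K)))
    (λ α → det (matrixB α)) λ {K} K∈ →
    trans (cong +_ (trans (length-map reverse (words s n (reverse K)))
                          (length-words s n (reverse K) (ℕ.≤-reflexive (length-expand-reverse n K∈)))))
          (det-matrixB K))

theorem4p3 : (n : ℕ) .{{_ : NonZero n}} →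
    (pf n σ132 ≡ pf n σ231 ×
    + pf n σ231 ≡ ∑[ α ⊨ n ] (det (matrixA α) ℤ.* det (matrixB α)))
    ×
    (pf n σ213 ≡ pf n σ312 ×
    + pf n σ312 ≡ ∑[ α ⊨ n ] (det (matrixA α) ℤ.* det (matrixC α)))
theorem4p3 n =
  (ℤ.+-injective (trans (pf-backward {n} σ132 high avoids-132) (sym pf231)) , pf231) ,
  (ℤ.+-injective (trans (pf-forward {n} σ213 high avoids-213) (sym pf312)) , pf312)
  where
  pf231 = pf-backward {n} σ231 low avoids-231
  pf312 = pf-forward {n} σ312 low avoids-312
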